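{- For every fixed integer $r\ge 3$ we have $$W(r,k)=\Omega\bigl(k^{r-1}/(\log k)^{r-2}\bigr)\qquad\text{as } k\to\infty,$$ where the implicit constant may depend on $r$.
   Context: For integers $r,k\ge 2$, the van der Waerden number $W(r,k)$ is the smallest integer $n$ such that every coloring of $[n]=\{1,\dots,n\}$ with the two colors red and blue contains either a red $r$-term arithmetic progression or a blue $k$-term arithmetic progression. -}

module Defs where

open import Data.Nat using (ℕ; _+_; _*_; _≤_; _<_)
open import Data.Bool using (Bool; true; false)
open import Data.Product using (∃-syntax; _×_)
open import Relation.Binary.PropositionalEquality using (_≡_)
open import Data.Sum using (_⊎_)

-- A 2-colouring of the positive integers; only its values on [n] = {1..n} matter.
-- Colour true = red, false = blue.
Colouring : Set
Colouring = ℕ → Bool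

MonoAP : Colouring → Bool → ℕ → ℕ → Set
MonoAP c b m n =
  ∃[ a ] ∃[ d ] (1 ≤ a × 1 ≤ d × (∀ i → i < m → (a + i * d ≤ n × c (a + i * d) ≡ b)))

-- n has the van der Waerden property for (r,k): every red/blue colouring of [n]
-- contains a red r-AP or a blue k-AP.  W(r,k) is the least such n.
VdWProp : ℕ → ℕ → ℕ → Set
VdWProp r k n = (c : Colouring) → MonoAP c true r n ⊎ MonoAP c false k n

{-# OPTIONS --safe #-}
module Submission where

-- It suffices to show that W(3,k) exceeds every fixed power of k (Green's phenomenon): the logarithms
-- then play no role. Colour p red when p + λ·x ∈ U for some x in a sphere S of the box [0,L)^D, with
-- L a small power of k. The vector λ is generic, so that the image λ·S contains no 3-term progression,
-- while a k-term progression meets each translate of λ·S in at most L^s points, with s independent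
-- of D: more points would give s + 1 equations λ·δ = e d in triangular form. The set U is random.
-- The second differences of λ·S lie in the image of a box with only (4L+1)^D points, far fewer than
-- |S|^3, so the triples that U must avoid are so few that U can still be dense enough to hit every
-- k-term progression.

open import Defs
open import Data.Nat
open import Data.Nat.Properties
open import Data.Nat.DivMod using (_/_; _%_; m≡m%n+[m/n]*n; m%n<n; m/n*n≤m; /-monoˡ-≤; m*n/n≡m)
open import Data.Nat.ListAction using (sum)
open import Data.Nat.Logarithm using (⌊log₂_⌋; ⌊log₂⌋-mono-≤; ⌊log₂[2^n]⌋≡n)
open import Data.Nat.Tactic.RingSolver using (solve-∀)
open import Data.Bool using (Bool; true; false)
import Data.Bool as Bool
open import Data.Empty using (⊥-elim)
open import Data.Fin using (Fin; zero; suc; toℕ; fromℕ<)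
import Data.Fin as Fin
import Data.Fin.Properties as Fin
import Data.Fin.Subset as Sub
open Sub using (Subset; _-_; ∣_∣)
open import Data.Fin.Subset.Properties using (p─q⊆p; x∈p⇒∣p-x∣<∣p∣; ∣p─q∣≤∣p∣; ∈⊤; _∈?_; x∈p∧x≢y⇒x∈p-y)
open import Data.List using (List; []; _∷_; _++_; map; length; filter; upTo; allFin; concatMap; replicate; cartesianProduct; cartesianProductWith)
open import Data.List.Properties using (length-++; length-map; length-upTo; length-replicate; length-filter; length-tabulate)
open import Data.List.Membership.Propositional using (_∈_; lose; find)
open import Data.List.Membership.Propositional.Properties
open import Data.List.Relation.Unary.All using (All; []; _∷_)
import Data.List.Relation.Unary.All as All
open import Data.List.Relation.Unary.AllPairs using ([]; _∷_)
open import Data.List.Relation.Unary.Any using (here; there; any?)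
open import Data.List.Relation.Unary.Unique.Propositional using (Unique)
import Data.List.Relation.Unary.Unique.Propositional.Properties as Unique
import Data.List.Relation.Unary.Unique.DecPropositional as DecUnique
open import Data.Product using (∃-syntax; _×_; _,_; proj₁; proj₂)
open import Data.Sum using (inj₁; inj₂; [_,_]′)
open import Data.Unit using (⊤; tt)
open import Data.Vec using (Vec; []; _∷_; lookup; tabulate; zipWith; _[_]≔_; there)
import Data.Vec as Vec
open import Data.Vec.Properties using (∷-injective; lookup∘update; lookup∘update′; []≔-idempotent; []≔-lookup; lookup-replicate; lookup-zipWith; lookup∘tabulate; tabulate∘lookup; tabulate-cong)
import Data.Vec.Relation.Unary.All as VecAll
import Data.Vec.Relation.Unary.All.Properties as VecAllₚ
open VecAll using () renaming (All to VAll; [] to []ᵛ; _∷_ to _∷ᵛ_)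
open import Function using (_∘_)
open import Relation.Binary.Definitions using (DecidableEquality)
open import Relation.Binary.PropositionalEquality
open import Relation.Nullary using (¬_; Dec; yes; no; ¬?; does)
open import Relation.Nullary.Decidable using (_×-dec_; _→-dec_; dec-true)

-- The exponents balance as follows. Measure in powers of L: |S| is about L^D, k is L^E, n is L^A
-- and U has density about L^-H. Hitting all k-term progressions needs H a little below D + E - s,
-- and avoiding the forbidden triples needs A + D a little below 2H. With D = 0 these two conditions
-- stop at n < k^2. Each further dimension raises the ceiling for H by one, so 2H by two, and costs
-- the triples only one: A gains one. The brake is λ. Its entries lie below N, and N cannot exceed
-- n, since λ·S must not be longer than the interval that is coloured. A union bound over all
-- differences d up to n and all systems of s + 1 equations needs N^(s+1) to exceed n (k L^D)^(s+1)
-- roughly. A single equation would ask for N > n k L^D, which is impossible; spread over s + 1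
-- equations, the factor n costs only n^(1/(s+1)), and the price is that a value may be taken L^s
-- times.

private
  variable
    A B : Set

-- Finite sums, indicators and the pigeonhole principle

∑ : List A → (A → ℕ) → ℕ
∑ xs f = sum (map f xs)

𝟙 : {P : Set} → Dec P → ℕ
𝟙 (yes _) = 1
𝟙 (no _)  = 0

𝟙-yes : {P : Set} (P? : Dec P) → P → 𝟙 P? ≡ 1
𝟙-yes (yes _) _ = refl
𝟙-yes (no ¬p) p = ⊥-elim (¬p p)

𝟙-no : {P : Set} (P? : Dec P) → ¬ P → 𝟙 P? ≡ 0
𝟙-no (yes p) ¬p = ⊥-elim (¬p p)
𝟙-no (no _)  _  = refl

𝟙-mono : {P Q : Set} (P? : Dec P) (Q? : Dec Q) → (P → Q) → 𝟙 P? ≤ 𝟙 Q?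
𝟙-mono (yes p) Q? f = ≤-reflexive (sym (𝟙-yes Q? (f p)))
𝟙-mono (no _)  Q? f = z≤n

𝟙-⇔ : {P Q : Set} (P? : Dec P) (Q? : Dec Q) → (P → Q) → (Q → P) → 𝟙 P? ≡ 𝟙 Q?
𝟙-⇔ P? Q? f g = ≤-antisym (𝟙-mono P? Q? f) (𝟙-mono Q? P? g)

𝟙-pos : {P : Set} (P? : Dec P) → 0 < 𝟙 P? → P
𝟙-pos (yes p) _ = p
𝟙-pos (no _) ()

∑-mono-∈ : (xs : List A) {f g : A → ℕ} → (∀ {x} → x ∈ xs → f x ≤ g x) → ∑ xs f ≤ ∑ xs g
∑-mono-∈ []       f≤g = z≤n
∑-mono-∈ (x ∷ xs) f≤g = +-mono-≤ (f≤g (here refl)) (∑-mono-∈ xs (f≤g ∘ there))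

∑-mono : (xs : List A) {f g : A → ℕ} → (∀ x → f x ≤ g x) → ∑ xs f ≤ ∑ xs g
∑-mono xs f≤g = ∑-mono-∈ xs (λ {x} _ → f≤g x)

∑-cong : (xs : List A) {f g : A → ℕ} → (∀ x → f x ≡ g x) → ∑ xs f ≡ ∑ xs g
∑-cong []       f≡g = refl
∑-cong (x ∷ xs) f≡g = cong₂ _+_ (f≡g x) (∑-cong xs f≡g)

∑-+ : (xs : List A) (f g : A → ℕ) → ∑ xs (λ x → f x + g x) ≡ ∑ xs f + ∑ xs g
∑-+ []       f g = refl
∑-+ (x ∷ xs) f g = trans (cong (f x + g x +_) (∑-+ xs f g)) (shuffle (f x) (g x) (∑ xs f) (∑ xs g))
  where
  shuffle : ∀ a b c d → a + b + (c + d) ≡ a + c + (b + d)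
  shuffle = solve-∀

∑-*ˡ : (xs : List A) (c : ℕ) (f : A → ℕ) → ∑ xs (λ x → c * f x) ≡ c * ∑ xs f
∑-*ˡ []       c f = sym (*-zeroʳ c)
∑-*ˡ (x ∷ xs) c f = trans (cong (c * f x +_) (∑-*ˡ xs c f)) (sym (*-distribˡ-+ c (f x) (∑ xs f)))

∑-const : (xs : List A) (c : ℕ) → ∑ xs (λ _ → c) ≡ length xs * c
∑-const []       c = refl
∑-const (x ∷ xs) c = cong (c +_) (∑-const xs c)

length-∑ : (xs : List A) → length xs ≡ ∑ xs (λ _ → 1)
length-∑ xs = sym (trans (∑-const xs 1) (*-identityʳ (length xs)))

∑-++ : (xs ys : List A) (f : A → ℕ) → ∑ (xs ++ ys) f ≡ ∑ xs f + ∑ ys f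
∑-++ []       ys f = refl
∑-++ (x ∷ xs) ys f = trans (cong (f x +_) (∑-++ xs ys f)) (sym (+-assoc (f x) (∑ xs f) (∑ ys f)))

∑-map : (h : A → B) (xs : List A) (f : B → ℕ) → ∑ (map h xs) f ≡ ∑ xs (f ∘ h)
∑-map h []       f = refl
∑-map h (x ∷ xs) f = cong (f (h x) +_) (∑-map h xs f)

∑-cartesianProductWith : {C : Set} (h : A → B → C) (xs : List A) (ys : List B) (f : C → ℕ) →
                         ∑ (cartesianProductWith h xs ys) f ≡ ∑ xs (λ x → ∑ ys (λ y → f (h x y)))
∑-cartesianProductWith h []       ys f = refl
∑-cartesianProductWith h (x ∷ xs) ys f =
  trans (∑-++ (map (h x) ys) (cartesianProductWith h xs ys) f)
        (cong₂ _+_ (∑-map (h x) ys f) (∑-cartesianProductWith h xs ys f))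

∑-swap : (xs : List A) (ys : List B) (f : A → B → ℕ) →
         ∑ xs (λ x → ∑ ys (f x)) ≡ ∑ ys (λ y → ∑ xs (λ x → f x y))
∑-swap []       ys f = sym (trans (∑-const ys 0) (*-zeroʳ (length ys)))
∑-swap (x ∷ xs) ys f = trans (cong (∑ ys (f x) +_) (∑-swap xs ys f)) (sym (∑-+ ys (f x) _))

∑-pos : (xs : List A) (f : A → ℕ) → 0 < ∑ xs f → ∃[ x ] (x ∈ xs × 0 < f x)
∑-pos (x ∷ xs) f pos with f x in eq
... | suc m = x , here refl , subst (0 <_) (sym eq) z<s
... | zero  with ∑-pos xs f pos
...   | y , y∈ , p = y , there y∈ , p

term≤∑ : {xs : List A} {x : A} (f : A → ℕ) → x ∈ xs → f x ≤ ∑ xs f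
term≤∑ f (here refl) = m≤m+n _ _
term≤∑ {xs = y ∷ _} f (there x∈) = ≤-trans (term≤∑ f x∈) (m≤n+m _ (f y))

length-filter-∑ : {P : A → Set} (P? : ∀ x → Dec (P x)) (xs : List A) →
                  length (filter P? xs) ≡ ∑ xs (𝟙 ∘ P?)
length-filter-∑ P? []       = refl
length-filter-∑ P? (x ∷ xs) with P? x
... | yes _ = cong suc (length-filter-∑ P? xs)
... | no  _ = length-filter-∑ P? xs

length-concatMap≤ : (h : A → List B) (xs : List A) {m : ℕ} → (∀ x → length (h x) ≤ m) →
                    length (concatMap h xs) ≤ length xs * m
length-concatMap≤ h []       h≤m = z≤n
length-concatMap≤ h (x ∷ xs) {m} h≤m = begin
  length (h x ++ concatMap h xs)         ≡⟨ length-++ (h x) ⟩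
  length (h x) + length (concatMap h xs) ≤⟨ +-mono-≤ (h≤m x) (length-concatMap≤ h xs h≤m) ⟩
  m + length xs * m                      ∎
  where open ≤-Reasoning


∑≤length*term : (vs : List ℕ) (f : ℕ → ℕ) → ∃[ v ] (∑ vs f ≤ length vs * f v)
∑≤length*term []       f = 0 , z≤n
∑≤length*term (w ∷ vs) f with ∑≤length*term vs f
... | v , le with ≤-total (f w) (f v)
...   | inj₁ w≤v = v , +-mono-≤ w≤v le
...   | inj₂ v≤w = w , +-monoʳ-≤ (f w) (≤-trans le (*-monoʳ-≤ (length vs) v≤w))

pigeonhole : (xs : List A) (m : ℕ) (c : A → ℕ) → (∀ {x} → x ∈ xs → c x < m) →
             ∃[ v ] (length xs ≤ m * length (filter (λ x → c x ≟ v) xs))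
pigeonhole xs m c c<m with ∑≤length*term (upTo m) (λ v → length (filter (λ x → c x ≟ v) xs))
... | v , le = v , (begin
  length xs                                       ≡⟨ length-∑ xs ⟩
  ∑ xs (λ _ → 1)                                  ≤⟨ ∑-mono-∈ xs (λ {x} x∈ → ≤-trans
                                                       (≤-reflexive (sym (𝟙-yes (c x ≟ c x) refl)))
                                                       (term≤∑ (λ v → 𝟙 (c x ≟ v)) (∈-upTo⁺ (c<m x∈)))) ⟩
  ∑ xs (λ x → ∑ (upTo m) (λ v → 𝟙 (c x ≟ v)))     ≡⟨ ∑-swap xs (upTo m) _ ⟩
  ∑ (upTo m) (λ v → ∑ xs (λ x → 𝟙 (c x ≟ v)))     ≡⟨ ∑-cong (upTo m) (λ v → sym (length-filter-∑ (λ x → c x ≟ v) xs)) ⟩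
  ∑ (upTo m) (λ v → length (filter (λ x → c x ≟ v) xs)) ≤⟨ le ⟩
  length (upTo m) * length (filter (λ x → c x ≟ v) xs)  ≡⟨ cong (_* _) (length-upTo m) ⟩
  m * length (filter (λ x → c x ≟ v) xs)          ∎)
  where open ≤-Reasoning

-- Finite product spaces

vecs : List A → (n : ℕ) → List (Vec A n)
vecs xs zero    = [] ∷ []
vecs xs (suc n) = cartesianProductWith _∷_ xs (vecs xs n)

∑-vecs-suc : (xs : List A) (n : ℕ) (f : Vec A (suc n) → ℕ) →
             ∑ (vecs xs (suc n)) f ≡ ∑ xs (λ a → ∑ (vecs xs n) (λ ω → f (a ∷ ω)))
∑-vecs-suc xs n f = ∑-cartesianProductWith _∷_ xs (vecs xs n) f

length-cartesianProductWith : {C : Set} (h : A → B → C) (xs : List A) (ys : List B) →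
                              length (cartesianProductWith h xs ys) ≡ length xs * length ys
length-cartesianProductWith h xs ys = begin
  length (cartesianProductWith h xs ys)       ≡⟨ length-∑ (cartesianProductWith h xs ys) ⟩
  ∑ (cartesianProductWith h xs ys) (λ _ → 1)  ≡⟨ ∑-cartesianProductWith h xs ys _ ⟩
  ∑ xs (λ _ → ∑ ys (λ _ → 1))                 ≡⟨ ∑-const xs _ ⟩
  length xs * ∑ ys (λ _ → 1)                  ≡⟨ cong (length xs *_) (sym (length-∑ ys)) ⟩
  length xs * length ys                       ∎
  where open ≡-Reasoning

length-vecs : (xs : List A) (n : ℕ) → length (vecs xs n) ≡ length xs ^ n
length-vecs xs zero    = refl
length-vecs xs (suc n) =
  trans (length-cartesianProductWith _∷_ xs (vecs xs n)) (cong (length xs *_) (length-vecs xs n))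

∈-vecs⁺ : {xs : List A} {n : ℕ} (ω : Vec A n) → (∀ i → lookup ω i ∈ xs) → ω ∈ vecs xs n
∈-vecs⁺ []      _  = here refl
∈-vecs⁺ (a ∷ ω) ω∈ = ∈-cartesianProductWith⁺ _∷_ (ω∈ zero) (∈-vecs⁺ ω (ω∈ ∘ suc))

∈-vecs⁻ : {xs : List A} {n : ℕ} (ω : Vec A n) → ω ∈ vecs xs n → ∀ i → lookup ω i ∈ xs
∈-vecs⁻ {xs = xs} {suc n} ω ω∈ i with ∈-cartesianProductWith⁻ _∷_ xs (vecs xs n) ω∈
∈-vecs⁻ {xs = xs} {suc n} _ _ zero    | a , ω , a∈ , ω∈ , refl = a∈
∈-vecs⁻ {xs = xs} {suc n} _ _ (suc i) | a , ω , a∈ , ω∈ , refl = ∈-vecs⁻ ω ω∈ i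

vecs-unique : {xs : List A} (n : ℕ) → Unique xs → Unique (vecs xs n)
vecs-unique zero    uniq = [] ∷ []
vecs-unique (suc n) uniq = Unique.cartesianProductWith⁺ _∷_ ∷-injective uniq (vecs-unique n uniq)

-- Integrating out one coordinate, on which the factor f does not depend.
∑-coordinate : (xs : List A) {n b : ℕ} (i : Fin n) (f g : Vec A n → ℕ) →
               (∀ ω a → f (ω [ i ]≔ a) ≡ f ω) →
               (∀ ω → ∑ xs (λ a → g (ω [ i ]≔ a)) ≤ b) →
               length xs * ∑ (vecs xs n) (λ ω → f ω * g ω) ≤ b * ∑ (vecs xs n) f
∑-coordinate [] {b = b} i f g f-ind g≤b = z≤n
∑-coordinate xs@(a₀ ∷ _) {suc n} {b} zero f g f-ind g≤b = begin
  length xs * ∑ (vecs xs (suc n)) (λ ω → f ω * g ω)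
    ≡⟨ cong (length xs *_) (∑-vecs-suc xs n _) ⟩
  length xs * ∑ xs (λ a → ∑ Ω (λ ω → f (a ∷ ω) * g (a ∷ ω)))
    ≡⟨ cong (length xs *_) (∑-swap xs Ω _) ⟩
  length xs * ∑ Ω (λ ω → ∑ xs (λ a → f (a ∷ ω) * g (a ∷ ω)))
    ≡⟨ cong (length xs *_) (∑-cong Ω (λ ω → trans (∑-cong xs (λ a → cong (_* g (a ∷ ω)) (f-ind (a₀ ∷ ω) a)))
                                                    (∑-*ˡ xs (f₀ ω) _))) ⟩
  length xs * ∑ Ω (λ ω → f₀ ω * ∑ xs (λ a → g (a ∷ ω)))
    ≤⟨ *-monoʳ-≤ (length xs) (∑-mono Ω (λ ω → *-monoʳ-≤ (f₀ ω) (g≤b (a₀ ∷ ω)))) ⟩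
  length xs * ∑ Ω (λ ω → f₀ ω * b)
    ≡⟨ cong (length xs *_) (trans (∑-cong Ω (λ ω → *-comm (f₀ ω) b)) (∑-*ˡ Ω b f₀)) ⟩
  length xs * (b * ∑ Ω f₀)
    ≡⟨ swap (length xs) b (∑ Ω f₀) ⟩
  b * (length xs * ∑ Ω f₀)
    ≡⟨ cong (b *_) (sym (∑-const xs _)) ⟩
  b * ∑ xs (λ _ → ∑ Ω f₀)
    ≡⟨ cong (b *_) (∑-cong xs (λ a → ∑-cong Ω (λ ω → sym (f-ind (a₀ ∷ ω) a)))) ⟩
  b * ∑ xs (λ a → ∑ Ω (λ ω → f (a ∷ ω)))
    ≡⟨ cong (b *_) (sym (∑-vecs-suc xs n f)) ⟩
  b * ∑ (vecs xs (suc n)) f ∎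
  where
  open ≤-Reasoning
  Ω = vecs xs n
  f₀ = λ ω → f (a₀ ∷ ω)
  swap : ∀ x y z → x * (y * z) ≡ y * (x * z)
  swap = solve-∀
∑-coordinate xs {suc n} {b} (suc i) f g f-ind g≤b = begin
  length xs * ∑ (vecs xs (suc n)) (λ ω → f ω * g ω)
    ≡⟨ cong (length xs *_) (∑-vecs-suc xs n _) ⟩
  length xs * ∑ xs (λ a → ∑ Ω (λ ω → f (a ∷ ω) * g (a ∷ ω)))
    ≡⟨ sym (∑-*ˡ xs (length xs) _) ⟩
  ∑ xs (λ a → length xs * ∑ Ω (λ ω → f (a ∷ ω) * g (a ∷ ω)))
    ≤⟨ ∑-mono xs (λ a → ∑-coordinate xs i (λ ω → f (a ∷ ω)) (λ ω → g (a ∷ ω))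
                          (λ ω → f-ind (a ∷ ω)) (λ ω → g≤b (a ∷ ω))) ⟩
  ∑ xs (λ a → b * ∑ Ω (λ ω → f (a ∷ ω)))
    ≡⟨ ∑-*ˡ xs b _ ⟩
  b * ∑ xs (λ a → ∑ Ω (λ ω → f (a ∷ ω)))
    ≡⟨ cong (b *_) (sym (∑-vecs-suc xs n f)) ⟩
  b * ∑ (vecs xs (suc n)) f ∎
  where
  open ≤-Reasoning
  Ω = vecs xs n

-- Counting in place of the local lemma

x∉p-x : ∀ {n} (p : Subset n) x → ¬ (x Sub.∈ p - x)
x∉p-x (_ ∷ p) zero ()
x∉p-x (_ ∷ p) (suc x) (there h) = x∉p-x p x h

infixl 5 _⊖_

_⊖_ : ∀ {n} → Subset n → List (Fin n) → Subset n
X ⊖ []      = X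
X ⊖ (u ∷ e) = (X - u) ⊖ e

⊖-⊆ : ∀ {n} (X : Subset n) e → X ⊖ e Sub.⊆ X
⊖-⊆ X []      v∈ = v∈
⊖-⊆ X (u ∷ e) v∈ = p─q⊆p X _ (⊖-⊆ (X - u) e v∈)

∈⇒∉⊖ : ∀ {n} (X : Subset n) {v} e → v ∈ e → ¬ (v Sub.∈ X ⊖ e)
∈⇒∉⊖ X (u ∷ e) (here refl) v∈ = x∉p-x X u (⊖-⊆ (X - u) e v∈)
∈⇒∉⊖ X (u ∷ e) (there v∈e) v∈ = ∈⇒∉⊖ (X - u) e v∈e v∈

module Counting (V b : ℕ) where

  -- `Q` is the number of letters, and `β / Q` is the least factor by which the count of good
  -- colourings may drop when one vertex is added. Two red letters rather than one keep `b < β`: the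
  -- ratio `b / β` must be below 1 for a large blue event to be rare after the correction by `Q / β`
  -- at each of its vertices.
  β Q : ℕ
  β = 1 + b
  Q = 2 + b

  -- A letter drawn uniformly from this list is red (true) with probability 2/Q.
  palette : List Bool
  palette = true ∷ true ∷ replicate b false

  multiplicity : Bool → ℕ
  multiplicity true  = 2
  multiplicity false = b

  ∑-palette : ∀ κ → ∑ palette (λ a → 𝟙 (a Bool.≟ κ)) ≡ multiplicity κ
  ∑-palette true  = cong (2 +_) (go b)
    where
    go : ∀ b → ∑ (replicate b false) (λ a → 𝟙 (a Bool.≟ true)) ≡ 0
    go zero    = refl
    go (suc b) = go b
  ∑-palette false = go b
    where
    go : ∀ b → ∑ (replicate b false) (λ a → 𝟙 (a Bool.≟ false)) ≡ b
    go zero    = refl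
    go (suc b) = cong suc (go b)

  length-palette : length palette ≡ Q
  length-palette = cong (2 +_) (length-replicate b)

  Ω : List (Vec Bool V)
  Ω = vecs palette V

  Occurs : Bool → List (Fin V) → Vec Bool V → Set
  Occurs κ e ω = All (λ u → lookup ω u ≡ κ) e

  occ : Bool → List (Fin V) → Vec Bool V → ℕ
  occ κ []      ω = 1
  occ κ (u ∷ e) ω = occ κ e ω * 𝟙 (lookup ω u Bool.≟ κ)

  ¬Occurs : ∀ {κ} e ω → occ κ e ω ≡ 0 → ¬ Occurs κ e ω
  ¬Occurs {κ} e ω ≡0 all = case (trans (sym (one e all)) ≡0)
    where
    one : ∀ e → Occurs κ e ω → occ κ e ω ≡ 1
    one []      []       = refl
    one (u ∷ e) (p ∷ ps) = cong₂ _*_ (one e ps) (𝟙-yes (lookup ω u Bool.≟ κ) p)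
    case : ¬ (1 ≡ 0)
    case ()

  occ-insensitive : ∀ κ e {u} → All (u ≢_) e → ∀ ω a → occ κ e (ω [ u ]≔ a) ≡ occ κ e ω
  occ-insensitive κ []      []        ω a = refl
  occ-insensitive κ (w ∷ e) (u≢w ∷ u∉e) ω a =
    cong₂ _*_ (occ-insensitive κ e u∉e ω a)
              (cong (λ z → 𝟙 (z Bool.≟ κ)) (lookup∘update′ (u≢w ∘ sym) ω a))

  -- The coordinates in `e` are integrated out one after another. As `e` has no repetition, `f`
  -- times the indicator of the remaining entries does not see the current coordinate.
  independence : ∀ κ e → Unique e → (f : Vec Bool V → ℕ) →
                 (∀ {u} → u ∈ e → ∀ ω a → f (ω [ u ]≔ a) ≡ f ω) →
                 Q ^ length e * ∑ Ω (λ ω → f ω * occ κ e ω) ≤ multiplicity κ ^ length e * ∑ Ω f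
  independence κ [] _ f f-ind =
    *-monoʳ-≤ 1 (≤-reflexive (∑-cong Ω (λ ω → *-identityʳ (f ω))))
  independence κ (u ∷ e) (u∉e ∷ uniq) f f-ind = begin
    Q * Q ^ ℓ * ∑ Ω (λ ω → f ω * (occ κ e ω * 𝟙 (lookup ω u Bool.≟ κ)))
      ≡⟨ cong (Q * Q ^ ℓ *_) (∑-cong Ω (λ ω → sym (*-assoc (f ω) (occ κ e ω) _))) ⟩
    Q * Q ^ ℓ * ∑ Ω (λ ω → f ω * occ κ e ω * 𝟙 (lookup ω u Bool.≟ κ))
      ≡⟨ shuffle Q (Q ^ ℓ) _ ⟩
    Q ^ ℓ * (Q * ∑ Ω (λ ω → f ω * occ κ e ω * 𝟙 (lookup ω u Bool.≟ κ)))
      ≡⟨ cong (λ q → Q ^ ℓ * (q * ∑ Ω (λ ω → f ω * occ κ e ω * 𝟙 (lookup ω u Bool.≟ κ)))) (sym length-palette) ⟩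
    Q ^ ℓ * (length palette * ∑ Ω (λ ω → f ω * occ κ e ω * 𝟙 (lookup ω u Bool.≟ κ)))
      ≤⟨ *-monoʳ-≤ (Q ^ ℓ) (∑-coordinate palette u (λ ω → f ω * occ κ e ω) (λ ω → 𝟙 (lookup ω u Bool.≟ κ))
           (λ ω a → cong₂ _*_ (f-ind (here refl) ω a) (occ-insensitive κ e u∉e ω a))
           (λ ω → ≤-reflexive (trans (∑-cong palette (λ a → cong (λ z → 𝟙 (z Bool.≟ κ)) (lookup∘update u ω a)))
                                     (∑-palette κ)))) ⟩
    Q ^ ℓ * (μ * ∑ Ω (λ ω → f ω * occ κ e ω))
      ≡⟨ shuffle′ (Q ^ ℓ) μ _ ⟩
    μ * (Q ^ ℓ * ∑ Ω (λ ω → f ω * occ κ e ω))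
      ≤⟨ *-monoʳ-≤ μ (independence κ e uniq f (f-ind ∘ there)) ⟩
    μ * (μ ^ ℓ * ∑ Ω f)
      ≡⟨ sym (*-assoc μ (μ ^ ℓ) _) ⟩
    μ * μ ^ ℓ * ∑ Ω f ∎
    where
    open ≤-Reasoning
    ℓ = length e
    μ = multiplicity κ
    shuffle : ∀ x y z → x * y * z ≡ y * (x * z)
    shuffle = solve-∀
    shuffle′ : ∀ x y z → x * (y * z) ≡ y * (x * z)
    shuffle′ = solve-∀

  record EventClass : Set where
    field
      colour     : Bool
      events     : Fin V → List (List (Fin V))
      size bound : ℕ
      few        : ∀ v → length (events v) ≤ bound
      shape      : ∀ {v e} → e ∈ events v → Unique e × length e ≡ size
      -- Each vertex of an event contributes the probability `multiplicity / Q` of its colour and a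
      -- factor `Q / β` for dropping the constraints at it, hence `multiplicity / β`. The factor
      -- `3 * Q` gives each of the three classes a third of the permitted loss `1 / Q`.
      rare       : 3 * Q * (bound * multiplicity colour ^ size) ≤ β ^ size

  Avoids : EventClass → Fin V → Vec Bool V → Set
  Avoids C v ω = ∀ {e} → e ∈ EventClass.events C v → ¬ Occurs (EventClass.colour C) e ω

  -- Rosenfeld's counting argument, which replaces the Lovász local lemma.
  -- G X ω says that no bad event inside X occurs in ω.
  module Rosenfeld
    (G : Subset V → Vec Bool V → Set) (G? : ∀ X ω → Dec (G X ω))
    (G-antitone : ∀ {X Y} ω → X Sub.⊆ Y → G Y ω → G X ω)
    (G-local : ∀ {X u} ω a → ¬ (u Sub.∈ X) → G X ω → G X (ω [ u ]≔ a))
    (G-empty : ∀ {X} ω → (∀ v → ¬ (v Sub.∈ X)) → G X ω)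
    (C₁ C₂ C₃ : EventClass)
    (G-step : ∀ X v ω → G (X - v) ω → Avoids C₁ v ω → Avoids C₂ v ω → Avoids C₃ v ω → G X ω)
    where

    g : Subset V → Vec Bool V → ℕ
    g X ω = 𝟙 (G? X ω)

    count : Subset V → ℕ
    count X = ∑ Ω (g X)

    count-antitone : ∀ {X Y} → X Sub.⊆ Y → count Y ≤ count X
    count-antitone X⊆Y = ∑-mono Ω (λ ω → 𝟙-mono (G? _ ω) (G? _ ω) (G-antitone ω X⊆Y))

    g-insensitive : ∀ X {u} → ¬ (u Sub.∈ X) → ∀ ω a → g X (ω [ u ]≔ a) ≡ g X ω
    g-insensitive X {u} u∉X ω a = 𝟙-⇔ (G? X (ω [ u ]≔ a)) (G? X ω) back (G-local ω a u∉X)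
      where
      restore : (ω [ u ]≔ a) [ u ]≔ lookup ω u ≡ ω
      restore = trans ([]≔-idempotent ω u) ([]≔-lookup ω u)
      back : G X (ω [ u ]≔ a) → G X ω
      back h = subst (G X) restore (G-local (ω [ u ]≔ a) (lookup ω u) u∉X h)

    -- All coordinates are always coloured, those outside `X` freely, so `count X` is `Q ^ V` times
    -- the probability that no bad event lies inside `X`. The claim bounds from below by `β / Q` the
    -- conditional probability that putting `v` back does no harm.
    Claim : Subset V → Set
    Claim X = ∀ v → β * count (X - v) ≤ Q * count X

    claim-⊖ : ∀ {m} → (∀ X → ∣ X ∣ < m → Claim X) → ∀ e X → ∣ X ∣ < m →
              β ^ length e * count (X ⊖ e) ≤ Q ^ length e * count X
    claim-⊖ claim []      X X<m = ≤-refl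
    claim-⊖ claim (u ∷ e) X X<m = begin
      β * β ^ ℓ * count (X - u ⊖ e)   ≡⟨ *-assoc β (β ^ ℓ) _ ⟩
      β * (β ^ ℓ * count (X - u ⊖ e)) ≤⟨ *-monoʳ-≤ β (claim-⊖ claim e (X - u) (≤-<-trans (∣p─q∣≤∣p∣ X _) X<m)) ⟩
      β * (Q ^ ℓ * count (X - u))     ≡⟨ shuffle β (Q ^ ℓ) _ ⟩
      Q ^ ℓ * (β * count (X - u))     ≤⟨ *-monoʳ-≤ (Q ^ ℓ) (claim X X<m u) ⟩
      Q ^ ℓ * (Q * count X)           ≡⟨ shuffle′ (Q ^ ℓ) Q _ ⟩
      Q * Q ^ ℓ * count X             ∎
      where
      open ≤-Reasoning
      ℓ = length e
      shuffle : ∀ x y z → x * (y * z) ≡ y * (x * z)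
      shuffle = solve-∀
      shuffle′ : ∀ x y z → x * (y * z) ≡ y * x * z
      shuffle′ = solve-∀

    losses : EventClass → Fin V → Subset V → Vec Bool V → ℕ
    losses C v Y ω = ∑ (events v) (λ e → g Y ω * occ colour e ω)
      where open EventClass C

    -- An event `e` may be correlated with goodness on `Y`. Weakening the latter to `Y ⊖ e` makes
    -- the two independent, and the inductive claim bounds the price of the weakening by `Q / β` for
    -- each vertex of `e`.
    class-loss : ∀ C {m} → (∀ X → ∣ X ∣ < m → Claim X) → ∀ v Y → ∣ Y ∣ < m →
                 3 * Q * ∑ Ω (losses C v Y) ≤ count Y
    class-loss C claim v Y Y<m = *-cancelˡ-≤ (β ^ size) {{m^n≢0 β size}} (begin
      β ^ size * (3 * Q * ∑ Ω (losses C v Y))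
        ≡⟨ shuffle (β ^ size) (3 * Q) _ ⟩
      3 * Q * (β ^ size * ∑ Ω (losses C v Y))
        ≡⟨ cong (λ z → 3 * Q * (β ^ size * z)) (∑-swap Ω (events v) _) ⟩
      3 * Q * (β ^ size * ∑ (events v) (λ e → ∑ Ω (λ ω → g Y ω * occ colour e ω)))
        ≡⟨ cong (3 * Q *_) (sym (∑-*ˡ (events v) (β ^ size) _)) ⟩
      3 * Q * ∑ (events v) (λ e → β ^ size * ∑ Ω (λ ω → g Y ω * occ colour e ω))
        ≤⟨ *-monoʳ-≤ (3 * Q) (∑-mono-∈ (events v) (λ e∈ → single _ (shape e∈))) ⟩
      3 * Q * ∑ (events v) (λ _ → μ ^ size * count Y)
        ≡⟨ cong (3 * Q *_) (∑-const (events v) _) ⟩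
      3 * Q * (length (events v) * (μ ^ size * count Y))
        ≤⟨ *-monoʳ-≤ (3 * Q) (*-monoˡ-≤ _ (few v)) ⟩
      3 * Q * (bound * (μ ^ size * count Y))
        ≡⟨ shuffle′ (3 * Q) bound (μ ^ size) (count Y) ⟩
      3 * Q * (bound * μ ^ size) * count Y
        ≤⟨ *-monoˡ-≤ (count Y) rare ⟩
      β ^ size * count Y ∎)
      where
      open ≤-Reasoning
      open EventClass C
      μ = multiplicity colour
      shuffle : ∀ x y z → x * (y * z) ≡ y * (x * z)
      shuffle = solve-∀
      shuffle′ : ∀ x y z w → x * (y * (z * w)) ≡ x * (y * z) * w
      shuffle′ = solve-∀
      single : ∀ e → Unique e × length e ≡ size →
               β ^ size * ∑ Ω (λ ω → g Y ω * occ colour e ω) ≤ μ ^ size * count Y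
      single e (uniq , refl) = *-cancelˡ-≤ (Q ^ ℓ) {{m^n≢0 Q ℓ}} (begin
        Q ^ ℓ * (β ^ ℓ * ∑ Ω (λ ω → g Y ω * occ colour e ω))
          ≤⟨ *-monoʳ-≤ (Q ^ ℓ) (*-monoʳ-≤ (β ^ ℓ) (∑-mono Ω (λ ω →
               *-monoˡ-≤ (occ colour e ω) (𝟙-mono (G? Y ω) (G? (Y ⊖ e) ω) (G-antitone ω (⊖-⊆ Y e)))))) ⟩
        Q ^ ℓ * (β ^ ℓ * ∑ Ω (λ ω → g (Y ⊖ e) ω * occ colour e ω))
          ≡⟨ shuffle (Q ^ ℓ) (β ^ ℓ) _ ⟩
        β ^ ℓ * (Q ^ ℓ * ∑ Ω (λ ω → g (Y ⊖ e) ω * occ colour e ω))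
          ≤⟨ *-monoʳ-≤ (β ^ ℓ) (independence colour e uniq (g (Y ⊖ e))
               (λ u∈e → g-insensitive (Y ⊖ e) (∈⇒∉⊖ Y e u∈e))) ⟩
        β ^ ℓ * (μ ^ ℓ * count (Y ⊖ e))
          ≡⟨ shuffle (β ^ ℓ) (μ ^ ℓ) _ ⟩
        μ ^ ℓ * (β ^ ℓ * count (Y ⊖ e))
          ≤⟨ *-monoʳ-≤ (μ ^ ℓ) (claim-⊖ claim e Y Y<m) ⟩
        μ ^ ℓ * (Q ^ ℓ * count Y)
          ≡⟨ shuffle (μ ^ ℓ) (Q ^ ℓ) _ ⟩
        Q ^ ℓ * (μ ^ ℓ * count Y) ∎)
        where ℓ = length e

    no-loss : ∀ C v Y ω → G Y ω → losses C v Y ω ≡ 0 → Avoids C v ω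
    no-loss C v Y ω gY ≡0 {e} e∈ = ¬Occurs e ω (n≤0⇒n≡0 (begin
      occ colour e ω         ≡⟨ sym (*-identityˡ _) ⟩
      1 * occ colour e ω     ≡⟨ cong (_* occ colour e ω) (sym (𝟙-yes (G? Y ω) gY)) ⟩
      g Y ω * occ colour e ω ≤⟨ term≤∑ (λ e → g Y ω * occ colour e ω) e∈ ⟩
      losses C v Y ω         ≡⟨ ≡0 ⟩
      0 ∎))
      where
      open ≤-Reasoning
      open EventClass C

    pointwise : ∀ X v ω → g (X - v) ω ≤
      g X ω + (losses C₁ v (X - v) ω + (losses C₂ v (X - v) ω + losses C₃ v (X - v) ω))
    pointwise X v ω with G? (X - v) ω in eq | G? X ω
    ... | no _  | _     = z≤n
    ... | yes _ | yes _ = s≤s z≤n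
    ... | yes p | no ¬q = n≢0⇒n>0 λ ≡0 → ¬q (G-step X v ω p
            (avoid C₁ (m+n≡0⇒m≡0 _ ≡0))
            (avoid C₂ (m+n≡0⇒m≡0 _ (m+n≡0⇒n≡0 (l C₁) ≡0)))
            (avoid C₃ (m+n≡0⇒n≡0 (l C₂) (m+n≡0⇒n≡0 (l C₁) ≡0))))
      where
      l : EventClass → ℕ
      l C = ∑ (EventClass.events C v) (λ e → 1 * occ (EventClass.colour C) e ω)
      avoid : ∀ C → l C ≡ 0 → Avoids C v ω
      avoid C ≡0 = no-loss C v (X - v) ω p (trans (∑-cong (EventClass.events C v)
        (λ e → cong (_* occ (EventClass.colour C) e ω) (cong 𝟙 eq))) ≡0)

    claim-step : ∀ X → (∀ Y → ∣ Y ∣ < ∣ X ∣ → Claim Y) → Claim X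
    claim-step X claim v with v ∈? X
    ... | no v∉X = *-mono-≤ (n≤1+n β) (count-antitone X⊆X-v)
      where
      X⊆X-v : X Sub.⊆ X - v
      X⊆X-v x∈X = x∈p∧x≢y⇒x∈p-y x∈X λ { refl → v∉X x∈X }
    -- Since `Q = 1 + β`, adding `S` turns the left side into `Q * S`; it remains to see that the
    -- losses amount to at most the fraction `1 / Q` of `S`.
    ... | yes v∈X = +-cancelˡ-≤ S _ _ (begin
      S + β * S
        ≤⟨ *-monoʳ-≤ Q (∑-mono Ω (pointwise X v)) ⟩
      Q * ∑ Ω (λ ω → g X ω + (l₁ ω + (l₂ ω + l₃ ω)))
        ≡⟨ cong (Q *_) (trans (∑-+ Ω (g X) _) (cong (count X +_)
             (trans (∑-+ Ω l₁ _) (cong (∑ Ω l₁ +_) (∑-+ Ω l₂ l₃))))) ⟩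
      Q * (count X + (∑ Ω l₁ + (∑ Ω l₂ + ∑ Ω l₃)))
        ≡⟨ trans (*-distribˡ-+ Q (count X) _) (+-comm (Q * count X) _) ⟩
      Q * (∑ Ω l₁ + (∑ Ω l₂ + ∑ Ω l₃)) + Q * count X
        ≤⟨ +-monoˡ-≤ (Q * count X) total ⟩
      S + Q * count X ∎)
      where
      open ≤-Reasoning
      S = count (X - v)
      l₁ = losses C₁ v (X - v)
      l₂ = losses C₂ v (X - v)
      l₃ = losses C₃ v (X - v)
      bound : ∀ C → 3 * Q * ∑ Ω (losses C v (X - v)) ≤ S
      bound C = class-loss C claim v (X - v) (x∈p⇒∣p-x∣<∣p∣ v∈X)
      shuffle : ∀ q x y z → 3 * (q * (x + (y + z))) ≡ 3 * q * x + (3 * q * y + 3 * q * z)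
      shuffle = solve-∀
      thrice : ∀ s → s + (s + s) ≡ 3 * s
      thrice = solve-∀
      total : Q * (∑ Ω l₁ + (∑ Ω l₂ + ∑ Ω l₃)) ≤ S
      total = *-cancelˡ-≤ 3 (begin
        3 * (Q * (∑ Ω l₁ + (∑ Ω l₂ + ∑ Ω l₃)))
          ≡⟨ shuffle Q (∑ Ω l₁) (∑ Ω l₂) (∑ Ω l₃) ⟩
        3 * Q * ∑ Ω l₁ + (3 * Q * ∑ Ω l₂ + 3 * Q * ∑ Ω l₃)
          ≤⟨ +-mono-≤ (bound C₁) (+-mono-≤ (bound C₂) (bound C₃)) ⟩
        S + (S + S) ≡⟨ thrice S ⟩
        3 * S ∎)

    claim : ∀ m X → ∣ X ∣ < m → Claim X
    claim (suc m) X (s≤s X≤m) = claim-step X (λ Y Y<X → claim m Y (<-≤-trans Y<X X≤m))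

    -- Removing all vertices one by one leads from `count Sub.⊤` to the count for the empty set,
    -- which is `Q ^ V`. Each removal multiplies the count by at most `Q / β`, so `count Sub.⊤`
    -- cannot vanish.
    good-exists : ∃[ ω ] G Sub.⊤ ω
    good-exists with ∑-pos Ω (g Sub.⊤) count-pos
      where
      open ≤-Reasoning
      all = allFin V
      ∅-count : count (Sub.⊤ ⊖ all) ≡ Q ^ V
      ∅-count = begin-equality
        count (Sub.⊤ ⊖ all) ≡⟨ ∑-cong Ω (λ ω → 𝟙-yes (G? _ ω) (G-empty ω λ v → ∈⇒∉⊖ Sub.⊤ all (∈-allFin v))) ⟩
        ∑ Ω (λ _ → 1)       ≡⟨ sym (length-∑ Ω) ⟩
        length Ω            ≡⟨ length-vecs palette V ⟩
        length palette ^ V  ≡⟨ cong (_^ V) length-palette ⟩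
        Q ^ V ∎
      count-pos : 0 < count Sub.⊤
      count-pos = n≢0⇒n>0 λ ≡0 → <⇒≱ (begin-strict
        0                                         <⟨ m^n>0 β (length all) ⟩
        β ^ length all                            ≤⟨ m≤m*n (β ^ length all) (Q ^ V) {{m^n≢0 Q V}} ⟩
        β ^ length all * Q ^ V                    ∎) (begin
        β ^ length all * Q ^ V                    ≡⟨ cong (β ^ length all *_) (sym ∅-count) ⟩
        β ^ length all * count (Sub.⊤ ⊖ all)      ≤⟨ claim-⊖ (claim (suc ∣ Sub.⊤ {V} ∣)) all Sub.⊤ (n<1+n _) ⟩
        Q ^ length all * count Sub.⊤              ≡⟨ cong (Q ^ length all *_) ≡0 ⟩
        Q ^ length all * 0                        ≡⟨ *-zeroʳ (Q ^ length all) ⟩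
        0 ∎)
    ... | ω , _ , pos = ω , 𝟙-pos (G? Sub.⊤ ω) pos

-- A random set with few additive coincidences

-- The default for a number out of range is `v` itself: the lists built from it then repeat `v` and
-- are discarded by `regular`.
clip : ∀ {V} → Fin V → ℕ → Fin V
clip {V} v m with m <? V
... | yes m<V = fromℕ< m<V
... | no  _   = v

clip-toℕ : ∀ {V} (v u : Fin V) {m} → m ≡ toℕ u → clip v m ≡ u
clip-toℕ {V} v u refl with toℕ u <? V
... | yes u<V = Fin.fromℕ<-toℕ u u<V
... | no  u≮V = ⊥-elim (u≮V (Fin.toℕ<n u))

module Hitting (V κ b h : ℕ) (Δ : List ℕ) (F : List (List (Fin V))) where
  open Counting V b

  -- The second difference `u₁ + u₃ - 2 u₂` equals `δ - κ`. In the application `κ` is λ·`centre` and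
  -- `δ` is λ·z, so the right side is λ applied to the second difference encoded by `z`.
  Relation : ℕ → Fin V → Fin V → Fin V → Set
  Relation δ u₁ u₂ u₃ = toℕ u₁ + toℕ u₃ + κ ≡ toℕ u₂ + toℕ u₂ + δ

  Relation-sym : ∀ {δ u₁ u₂ u₃} → Relation δ u₁ u₂ u₃ → Relation δ u₃ u₂ u₁
  Relation-sym {u₁ = u₁} {u₃ = u₃} eq = trans (cong (_+ κ) (+-comm (toℕ u₃) (toℕ u₁))) eq

  regular : ℕ → List (List (Fin V)) → List (List (Fin V))
  regular ℓ = filter (λ e → DecUnique.unique? Fin._≟_ e ×-dec (length e ≟ ℓ))

  -- Solutions with exactly two values, one of them `v`. The four entries give the other value when
  -- it is an endpoint alone, the middle and an endpoint, the middle alone, and both endpoints;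
  -- exchanging the endpoints gives nothing new. Spurious values from truncated subtraction or
  -- rounded halving only forbid more, and they are counted in the bound.
  pairs : Fin V → ℕ → List (List (Fin V))
  pairs v δ = (v ∷ clip v (toℕ v + toℕ v + δ ∸ (toℕ v + κ)) ∷ [])
            ∷ (v ∷ clip v (toℕ v + κ ∸ δ) ∷ [])
            ∷ (v ∷ clip v ⌊ toℕ v + toℕ v + κ ∸ δ /2⌋ ∷ [])
            ∷ (v ∷ clip v ⌊ toℕ v + toℕ v + δ ∸ κ /2⌋ ∷ [])
            ∷ []

  -- Two of the three points and `δ` determine the last one. In the first entry `v` is an endpoint
  -- and `u` the middle, in the second `v` is the middle and `u` an endpoint.
  triples : Fin V → Fin V → ℕ → List (List (Fin V))
  triples v u δ = (v ∷ u ∷ clip v (toℕ u + toℕ u + δ ∸ (toℕ v + κ)) ∷ [])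
                ∷ (v ∷ u ∷ clip v (toℕ v + toℕ v + δ ∸ (toℕ u + κ)) ∷ [])
                ∷ []

  module _
    (shape : ∀ {e} → e ∈ F → Unique e × length e ≡ h) (h>0 : 0 < h)
    (rare₂ : 3 * Q * (length Δ * 4 * 2 ^ 2) ≤ β ^ 2)
    (rare₃ : 3 * Q * (V * (length Δ * 2) * 2 ^ 3) ≤ β ^ 3)
    (rareᵇ : 3 * Q * (length F * b ^ h) ≤ β ^ h)
    where

    pairClass tripleClass blueClass : EventClass
    pairClass = record
      { colour = true ; size = 2 ; bound = length Δ * 4
      ; events = λ v → regular 2 (concatMap (pairs v) Δ)
      ; few    = λ v → ≤-trans (length-filter _ (concatMap (pairs v) Δ))
                               (length-concatMap≤ (pairs v) Δ (λ _ → ≤-refl))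
      ; shape  = λ {v} e∈ → proj₂ (∈-filter⁻ _ {xs = concatMap (pairs v) Δ} e∈)
      ; rare   = rare₂ }
    tripleClass = record
      { colour = true ; size = 3 ; bound = V * (length Δ * 2)
      ; events = λ v → regular 3 (all v)
      ; few    = λ v → ≤-trans (length-filter _ (all v))
                 (subst (λ n → length (all v) ≤ n * (length Δ * 2)) (length-tabulate {n = V} (λ i → i))
                   (length-concatMap≤ (λ u → concatMap (triples v u) Δ) (allFin V)
                     (λ u → length-concatMap≤ (triples v u) Δ (λ _ → ≤-refl))))
      ; shape  = λ {v} e∈ → proj₂ (∈-filter⁻ _ {xs = all v} e∈)
      ; rare   = rare₃ }
      where
      all : Fin V → List (List (Fin V))
      all v = concatMap (λ u → concatMap (triples v u) Δ) (allFin V)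
    blueClass = record
      { colour = false ; size = h ; bound = length F
      -- Every blue event is charged to every vertex: its probability is so small that a plain union
      -- bound over `F` is affordable.
      ; events = λ _ → F
      ; few    = λ _ → ≤-refl
      ; shape  = shape
      ; rare   = rareᵇ }

    Active : Subset V → Vec Bool V → Fin V → Set
    Active X ω u = u Sub.∈ X × lookup ω u ≡ true

    active? : ∀ X ω u → Dec (Active X ω u)
    active? X ω u = (u ∈? X) ×-dec (lookup ω u Bool.≟ true)

    RedFree BlueFree Good : Subset V → Vec Bool V → Set
    RedFree X ω = ∀ u₁ u₂ u₃ → Active X ω u₁ → Active X ω u₂ → Active X ω u₃ →
                  All (λ δ → Relation δ u₁ u₂ u₃ → u₁ ≡ u₂ × u₂ ≡ u₃) Δ
    BlueFree X ω = All (λ e → ¬ (All (Sub._∈ X) e × Occurs false e ω)) F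
    Good X ω = RedFree X ω × BlueFree X ω

    good? : ∀ X ω → Dec (Good X ω)
    good? X ω =
      Fin.all? (λ u₁ → Fin.all? λ u₂ → Fin.all? λ u₃ →
        active? X ω u₁ →-dec (active? X ω u₂ →-dec (active? X ω u₃ →-dec
          All.all? (λ δ → (_ ≟ _) →-dec ((u₁ Fin.≟ u₂) ×-dec (u₂ Fin.≟ u₃))) Δ)))
      ×-dec All.all? (λ e → ¬? (All.all? (_∈? X) e ×-dec All.all? (λ u → lookup ω u Bool.≟ false) e)) F

    -- Goodness on `X` only sees the colours inside `X`. With `ω = ω′` this is monotonicity in the
    -- set, and with `X = Y` it is locality.
    good-via : ∀ {X Y ω ω′} → (∀ {u} → u Sub.∈ X → u Sub.∈ Y × lookup ω′ u ≡ lookup ω u) →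
               Good Y ω′ → Good X ω
    good-via {X} {Y} {ω} {ω′} f (red , blue) =
      (λ u₁ u₂ u₃ a₁ a₂ a₃ → red u₁ u₂ u₃ (active a₁) (active a₂) (active a₃)) ,
      All.map (λ ¬p (e⊆X , ω≡) → ¬p (All.map (proj₁ ∘ f) e⊆X ,
                                     All.zipWith (λ (u∈ , eq) → trans (proj₂ (f u∈)) eq) (e⊆X , ω≡))) blue
      where
      active : ∀ {u} → Active X ω u → Active Y ω′ u
      active (u∈X , eq) = proj₁ (f u∈X) , trans (proj₂ (f u∈X)) eq

    good-local : ∀ {X u} ω a → ¬ (u Sub.∈ X) → Good X ω → Good X (ω [ u ]≔ a)
    good-local {X} {u} ω a u∉X = good-via {ω = ω [ u ]≔ a} {ω} λ {w} w∈X →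
      w∈X , sym (lookup∘update′ (λ { refl → u∉X w∈X }) ω a)

    good-empty : ∀ {X} ω → (∀ v → ¬ (v Sub.∈ X)) → Good X ω
    good-empty {X} ω ∅ = (λ u₁ _ _ (u₁∈X , _) → ⊥-elim (∅ u₁ u₁∈X)) ,
                         All.tabulate λ {e} e∈ (e⊆X , _) → nonempty e (proj₂ (shape e∈)) e⊆X
      where
      nonempty : ∀ e → length e ≡ h → ¬ All (Sub._∈ X) e
      nonempty []      eq []        = <-irrefl eq h>0
      nonempty (u ∷ _) _  (u∈X ∷ _) = ∅ u u∈X

    good-step : ∀ X v ω → Good (X - v) ω → Avoids pairClass v ω → Avoids tripleClass v ω →
                Avoids blueClass v ω → Good X ω
    good-step X v ω (red , _) avoid₂ avoid₃ avoidᵇ =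
      (λ u₁ u₂ u₃ a₁ a₂ a₃ → All.tabulate (step u₁ u₂ u₃ a₁ a₂ a₃)) ,
      All.tabulate (λ e∈ (_ , occ) → avoidᵇ e∈ occ)
      where
      Red : Fin V → Set
      Red u = lookup ω u ≡ true

      no-pair : ∀ {δ u} → δ ∈ Δ → v ≢ u → Red v → Red u → ¬ ((v ∷ u ∷ []) ∈ pairs v δ)
      no-pair δ∈ v≢u rv ru e∈ = avoid₂
        (∈-filter⁺ _ (∈-concatMap⁺ (pairs v) (lose δ∈ e∈)) (((v≢u ∷ []) ∷ [] ∷ []) , refl))
        (rv ∷ ru ∷ [])

      no-triple : ∀ {δ u w} → δ ∈ Δ → v ≢ u → v ≢ w → u ≢ w → Red v → Red u → Red w →
                  ¬ ((v ∷ u ∷ w ∷ []) ∈ triples v u δ)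
      no-triple {δ} {u} δ∈ v≢u v≢w u≢w rv ru rw e∈ = avoid₃
        (∈-filter⁺ _ (∈-concatMap⁺ (λ u → concatMap (triples v u) Δ)
                       (lose (∈-allFin u) (∈-concatMap⁺ (triples v u) (lose δ∈ e∈))))
                     (((v≢u ∷ v≢w ∷ []) ∷ (u≢w ∷ []) ∷ [] ∷ []) , refl))
        (rv ∷ ru ∷ rw ∷ [])

      by-clip : ∀ (xs : List (Fin V)) {m u} → m ≡ toℕ u → _≡_ {A = List (Fin V)} (v ∷ xs ++ u ∷ []) (v ∷ xs ++ clip v m ∷ [])
      by-clip xs {u = u} eq = cong (λ z → v ∷ xs ++ z ∷ []) (sym (clip-toℕ v u eq))

      third : ∀ {δ u₁ u₂ u₃} → Relation δ u₁ u₂ u₃ → toℕ u₂ + toℕ u₂ + δ ∸ (toℕ u₁ + κ) ≡ toℕ u₃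
      third {δ} {u₁} {u₂} {u₃} eq = trans (cong (_∸ (toℕ u₁ + κ)) (trans (sym eq) (shuffle (toℕ u₁) (toℕ u₃) κ)))
                                     (m+n∸m≡n (toℕ u₁ + κ) (toℕ u₃))
        where
        shuffle : ∀ x y z → x + y + z ≡ x + z + y
        shuffle = solve-∀

      at-first : ∀ {δ u₂ u₃} → δ ∈ Δ → Red v → Red u₂ → Red u₃ → Relation δ v u₂ u₃ →
                 v ≡ u₂ × u₂ ≡ u₃
      at-first {δ} {u₂} {u₃} δ∈ rv r₂ r₃ eq with v Fin.≟ u₂ | u₂ Fin.≟ u₃ | v Fin.≟ u₃
      ... | yes v≡u₂ | yes u₂≡u₃ | _ = v≡u₂ , u₂≡u₃
      ... | yes refl | no v≢u₃ | _ = ⊥-elim (no-pair δ∈ v≢u₃ rv r₃ (here (by-clip [] (third {u₁ = v} {v} eq))))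
      ... | no v≢u₂ | yes refl | _ = ⊥-elim (no-pair δ∈ v≢u₂ rv r₂ (there (here (by-clip []
              (trans (cong (_∸ δ) (+-cancelˡ-≡ (toℕ u₂) _ _ (trans (shuffle (toℕ v) (toℕ u₂) κ) (trans eq (+-assoc (toℕ u₂) (toℕ u₂) δ)))))
                     (m+n∸n≡m (toℕ u₂) δ))))))
        where
        shuffle : ∀ x y z → y + (x + z) ≡ x + y + z
        shuffle = solve-∀
      ... | no v≢u₂ | no _ | yes refl = ⊥-elim (no-pair δ∈ v≢u₂ rv r₂ (there (there (here (by-clip []
              (trans (cong ⌊_/2⌋ (trans (cong (_∸ δ) eq) (m+n∸n≡m (toℕ u₂ + toℕ u₂) δ)))
                     (sym (n≡⌊n+n/2⌋ (toℕ u₂)))))))))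
      ... | no v≢u₂ | no u₂≢u₃ | no v≢u₃ =
              ⊥-elim (no-triple δ∈ v≢u₂ v≢u₃ u₂≢u₃ rv r₂ r₃ (here (by-clip (u₂ ∷ []) (third {u₁ = v} {u₂} eq))))

      at-second : ∀ {δ u₁ u₃} → δ ∈ Δ → u₁ ≢ v → v ≢ u₃ → Red u₁ → Red v → Red u₃ → ¬ Relation δ u₁ v u₃
      at-second {δ} {u₁} {u₃} δ∈ u₁≢v v≢u₃ r₁ rv r₃ eq with u₁ Fin.≟ u₃
      ... | yes refl = no-pair δ∈ v≢u₃ rv r₃ (there (there (there (here (by-clip []
              (trans (cong ⌊_/2⌋ (trans (cong (_∸ κ) (sym eq)) (m+n∸n≡m (toℕ u₁ + toℕ u₁) κ)))
                     (sym (n≡⌊n+n/2⌋ (toℕ u₁)))))))))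
      ... | no u₁≢u₃ = no-triple δ∈ (u₁≢v ∘ sym) v≢u₃ u₁≢u₃ rv r₁ r₃
                         (there (here (by-clip (u₁ ∷ []) (third {u₁ = u₁} {v} eq))))

      step : ∀ u₁ u₂ u₃ → Active X ω u₁ → Active X ω u₂ → Active X ω u₃ →
             ∀ {δ} → δ ∈ Δ → Relation δ u₁ u₂ u₃ → u₁ ≡ u₂ × u₂ ≡ u₃
      step u₁ u₂ u₃ (x₁ , r₁) (x₂ , r₂) (x₃ , r₃) δ∈ eq with u₁ Fin.≟ v | u₃ Fin.≟ v | u₂ Fin.≟ v
      ... | yes refl | _ | _ = at-first δ∈ r₁ r₂ r₃ eq
      ... | no _ | yes refl | _ with at-first δ∈ r₃ r₂ r₁ (Relation-sym {u₁ = u₁} {u₂} {u₃} eq)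
      ...   | refl , refl = refl , refl
      step u₁ u₂ u₃ (x₁ , r₁) (x₂ , r₂) (x₃ , r₃) δ∈ eq | no u₁≢v | no u₃≢v | yes refl =
        ⊥-elim (at-second δ∈ u₁≢v (u₃≢v ∘ sym) r₁ r₂ r₃ eq)
      step u₁ u₂ u₃ (x₁ , r₁) (x₂ , r₂) (x₃ , r₃) δ∈ eq | no u₁≢v | no u₃≢v | no u₂≢v =
        All.lookup (red u₁ u₂ u₃ (x∈p∧x≢y⇒x∈p-y x₁ u₁≢v , r₁) (x∈p∧x≢y⇒x∈p-y x₂ u₂≢v , r₂)
                                 (x∈p∧x≢y⇒x∈p-y x₃ u₃≢v , r₃)) δ∈ eq

    hitting-set : ∃[ ω ] ((∀ u₁ u₂ u₃ → lookup ω u₁ ≡ true → lookup ω u₂ ≡ true → lookup ω u₃ ≡ true →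
                             ∀ {δ} → δ ∈ Δ → Relation δ u₁ u₂ u₃ → u₁ ≡ u₂ × u₂ ≡ u₃)
                        × (∀ {e} → e ∈ F → ∃[ u ] (u ∈ e × lookup ω u ≡ true)))
    hitting-set with Rosenfeld.good-exists Good good?
                       (λ ω X⊆Y → good-via {ω = ω} {ω} (λ u∈X → X⊆Y u∈X , refl)) good-local good-empty
                       pairClass tripleClass blueClass good-step
    ... | ω , red , blue = ω ,
      (λ u₁ u₂ u₃ r₁ r₂ r₃ δ∈ → All.lookup (red u₁ u₂ u₃ (∈⊤ , r₁) (∈⊤ , r₂) (∈⊤ , r₃)) δ∈) ,
      λ {e} e∈ → hit e (λ occ → All.lookup blue e∈ (All.tabulate (λ _ → ∈⊤) , occ))
      where
      hit : ∀ e → ¬ Occurs false e ω → ∃[ u ] (u ∈ e × lookup ω u ≡ true)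
      hit []      ¬occ = ⊥-elim (¬occ [])
      hit (u ∷ e) ¬occ with lookup ω u in eq
      ... | true  = u , here refl , eq
      ... | false with hit e (λ occ → ¬occ (eq ∷ occ))
      ...   | w , w∈ , r = w , there w∈ , r

-- Generic dilations

∑-at-most-one : {A : Set} {P : A → Set} (P? : ∀ x → Dec (P x)) (xs : List A) → Unique xs →
                (∀ {x y} → P x → P y → x ≡ y) → ∑ xs (𝟙 ∘ P?) ≤ 1
∑-at-most-one P? []       _              _    = z≤n
∑-at-most-one P? (x ∷ xs) (x∉xs ∷ uniq) same with P? x
... | no _  = ∑-at-most-one P? xs uniq same
... | yes p = s≤s (≤-reflexive (zeros xs x∉xs))
  where
  zeros : ∀ ys → All (x ≢_) ys → ∑ ys (𝟙 ∘ P?) ≡ 0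
  zeros []       []           = refl
  zeros (y ∷ ys) (x≢y ∷ rest) = cong₂ _+_ (𝟙-no (P? y) (λ q → x≢y (same p q))) (zeros ys rest)

∑<length⇒zero : {A : Set} (xs : List A) (f : A → ℕ) → ∑ xs f < length xs → ∃[ x ] (x ∈ xs × f x ≡ 0)
∑<length⇒zero (x ∷ xs) f lt with f x in eq
... | zero  = x , here refl , eq
... | suc m with ∑<length⇒zero xs f (s≤s⁻¹ (≤-trans (s≤s (s≤s (m≤n+m _ m))) lt))
...   | y , y∈ , ≡0 = y , there y∈ , ≡0

∑≡0 : {A : Set} (xs : List A) (f : A → ℕ) → ∑ xs f ≡ 0 → ∀ {x} → x ∈ xs → f x ≡ 0
∑≡0 xs f ≡0 x∈ = n≤0⇒n≡0 (subst (f _ ≤_) ≡0 (term≤∑ f x∈))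

-- This is (a - a′)(z - m) = 0 without negative numbers.
cross-cancel : ∀ a a′ z m → a * z + a′ * m ≡ a * m + a′ * z → z ≢ m → a ≡ a′
cross-cancel a a′ z m eq z≢m = [ (λ a≤a′ → ordered a a′ a≤a′ eq)
                               , (λ a′≤a → sym (ordered a′ a a′≤a
                                   (trans (+-comm (a′ * z) (a * m)) (trans (sym eq) (+-comm (a * z) (a′ * m))))))
                               ]′ (≤-total a a′)
  where
  ordered : ∀ a a′ → a ≤ a′ → a * z + a′ * m ≡ a * m + a′ * z → a ≡ a′
  ordered a a′ a≤a′ eq with m≤n⇒∃[o]m+o≡n a≤a′
  ... | zero  , refl = sym (+-identityʳ a)
  ... | suc t , refl = ⊥-elim (z≢m (sym (*-cancelˡ-≡ m z (suc t)
          (+-cancelˡ-≡ (a * z + a * m) _ _ (trans (left a z m (suc t)) (trans eq (right a z m (suc t))))))))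
    where
    left : ∀ a z m t → a * z + a * m + t * m ≡ a * z + (a + t) * m
    left = solve-∀
    right : ∀ a z m t → a * m + (a + t) * z ≡ a * z + a * m + t * z
    right = solve-∀

dot : ∀ {D} → Vec ℕ D → Vec ℕ D → ℕ
dot []       []       = 0
dot (l ∷ ls) (x ∷ xs) = l * x + dot ls xs

dot-update : ∀ {D} (ls xs : Vec ℕ D) c a →
             dot (ls [ c ]≔ a) xs ≡ a * lookup xs c + dot (ls [ c ]≔ 0) xs
dot-update (l ∷ ls) (x ∷ xs) zero    a = refl
dot-update (l ∷ ls) (x ∷ xs) (suc c) a =
  trans (cong (l * x +_) (dot-update ls xs c a)) (shuffle (l * x) (a * lookup xs c) _)
  where
  shuffle : ∀ p q r → p + (q + r) ≡ q + (p + r)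
  shuffle = solve-∀

module Generic (D m k N : ℕ) where

  centre : Vec ℕ D
  centre = Vec.replicate D m

  Λ : List (Vec ℕ D)
  Λ = vecs (upTo N) D

  -- A difference x − y of points of the box together with a difference i − j of indices,
  -- encoded as x − y + centre and i − j + k to avoid negative numbers.
  Shift : Set
  Shift = Vec ℕ D × ℕ

  -- With `z = x - y + centre` and `e = i - j + k` the equation reads λ·x + i d = λ·y + j d: the
  -- terms `i` and `j` of a progression with difference `d`, translated by λ·x and λ·y, coincide.
  Solves : ℕ → Vec ℕ D → Shift → Set
  Solves d ls (z , e) = dot ls z + e * d ≡ dot ls centre + k * d

  solves? : ∀ d ls w → Dec (Solves d ls w)
  solves? d ls (z , e) = dot ls z + e * d ≟ dot ls centre + k * d

  -- A nonzero coordinate of a difference is one that differs from `m`. Each equation involves some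
  -- coordinate of λ that none of the later ones involves, so independence can be used one
  -- coordinate at a time, without determinants.
  Triangular : ∀ {s} → Vec Shift s → Set
  Triangular []             = ⊤
  Triangular ((z , _) ∷ ws) =
    ∃[ c ] (lookup z c ≢ m × VAll (λ w → lookup (proj₁ w) c ≡ m) ws) × Triangular ws

  triangular? : ∀ {s} (ws : Vec Shift s) → Dec (Triangular ws)
  triangular? []             = yes tt
  triangular? ((z , _) ∷ ws) =
    Fin.any? (λ c → (¬? (lookup z c ≟ m) ×-dec VecAll.all? (λ w → lookup (proj₁ w) c ≟ m) ws)
                    ×-dec triangular? ws)

  solved : ∀ {s} → ℕ → Vec Shift s → Vec ℕ D → ℕ
  solved d []       ls = 1
  solved d (w ∷ ws) ls = solved d ws ls * 𝟙 (solves? d ls w)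

  solved-all : ∀ {s} d (ws : Vec Shift s) ls → VAll (Solves d ls) ws → solved d ws ls ≡ 1
  solved-all d []       ls []ᵛ       = refl
  solved-all d (w ∷ ws) ls (p ∷ᵛ ps) = cong₂ _*_ (solved-all d ws ls ps) (𝟙-yes (solves? d ls w) p)

  dot-centre : ∀ ls c a → dot (ls [ c ]≔ a) centre ≡ a * m + dot (ls [ c ]≔ 0) centre
  dot-centre ls c a = trans (dot-update ls centre c a)
    (cong (λ x → a * x + dot (ls [ c ]≔ 0) centre) (lookup-replicate c m))

  solves-line : ∀ d ls z e c a → Solves d (ls [ c ]≔ a) (z , e) →
                a * lookup z c + (dot (ls [ c ]≔ 0) z + e * d) ≡
                a * m + (dot (ls [ c ]≔ 0) centre + k * d)
  solves-line d ls z e c a eq =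
    trans (sym (+-assoc (a * lookup z c) _ _))
      (trans (cong (_+ e * d) (sym (dot-update ls z c a)))
        (trans eq (trans (cong (_+ k * d) (dot-centre ls c a)) (+-assoc (a * m) _ _))))

  solves-line⁻ : ∀ d ls z e c a →
                a * lookup z c + (dot (ls [ c ]≔ 0) z + e * d) ≡
                a * m + (dot (ls [ c ]≔ 0) centre + k * d) →
                Solves d (ls [ c ]≔ a) (z , e)
  solves-line⁻ d ls z e c a eq =
    trans (cong (_+ e * d) (dot-update ls z c a))
      (trans (+-assoc (a * lookup z c) _ _)
        (trans eq (trans (sym (+-assoc (a * m) _ _)) (cong (_+ k * d) (sym (dot-centre ls c a))))))

  solves-flat : ∀ d z e c → lookup z c ≡ m → ∀ ls a b →
                Solves d (ls [ c ]≔ a) (z , e) → Solves d (ls [ c ]≔ b) (z , e)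
  solves-flat d z e c z≡m ls a b sol = solves-line⁻ d ls z e c b
    (trans (cong (λ x → b * x + p) z≡m) (cong (b * m +_) (+-cancelˡ-≡ (a * m) _ _
      (trans (cong (λ x → a * x + p) (sym z≡m)) (solves-line d ls z e c a sol)))))
    where p = dot (ls [ c ]≔ 0) z + e * d

  solves-unique : ∀ d z e c → lookup z c ≢ m → ∀ ls {a b} →
                  Solves d (ls [ c ]≔ a) (z , e) → Solves d (ls [ c ]≔ b) (z , e) → a ≡ b
  solves-unique d z e c z≢m ls {a} {b} sa sb = cross-cancel a b (lookup z c) m
    (+-cancelˡ-≡ (p + q) _ _ (trans (left p q (a * x) (b * m))
      (trans (cong₂ _+_ (solves-line d ls z e c a sa) (sym (solves-line d ls z e c b sb)))
        (right p q (a * m) (b * x))))) z≢m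
    where
    x = lookup z c
    p = dot (ls [ c ]≔ 0) z + e * d
    q = dot (ls [ c ]≔ 0) centre + k * d
    left : ∀ p q u v → p + q + (u + v) ≡ u + p + (v + q)
    left = solve-∀
    right : ∀ p q u v → u + q + (v + p) ≡ p + q + (u + v)
    right = solve-∀

  solved-flat : ∀ {s} d (ws : Vec Shift s) c → VAll (λ w → lookup (proj₁ w) c ≡ m) ws →
                ∀ ls a → solved d ws (ls [ c ]≔ a) ≡ solved d ws ls
  solved-flat d []             c []ᵛ           ls a = refl
  solved-flat d ((z , e) ∷ ws) c (z≡m ∷ᵛ flat) ls a = cong₂ _*_ (solved-flat d ws c flat ls a)
    (𝟙-⇔ (solves? d (ls [ c ]≔ a) (z , e)) (solves? d ls (z , e))
      (λ sol → subst (λ l → Solves d l (z , e)) ([]≔-lookup ls c) (solves-flat d z e c z≡m ls a (lookup ls c) sol))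
      (λ sol → solves-flat d z e c z≡m ls (lookup ls c) a (subst (λ l → Solves d l (z , e)) (sym ([]≔-lookup ls c)) sol)))

  length-Λ : length Λ ≡ N ^ D
  length-Λ = trans (length-vecs (upTo N) D) (cong (_^ D) (length-upTo N))

  -- When the entry `c` of λ varies and the others are fixed, the later equations do not change,
  -- while the first one holds for at most one of the `N` values. Hence every equation costs a
  -- factor `N`.
  solved-count : ∀ {s} d (ws : Vec Shift s) → Triangular ws → N ^ s * ∑ Λ (solved d ws) ≤ N ^ D
  solved-count d [] _ = ≤-reflexive (trans (*-identityˡ _) (trans (sym (length-∑ Λ)) length-Λ))
  solved-count {suc s} d ((z , e) ∷ ws) (c , (z≢m , flat) , tri) = begin
    N * N ^ s * ∑ Λ (λ ls → solved d ws ls * 𝟙 (solves? d ls (z , e)))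
      ≡⟨ shuffle N (N ^ s) _ ⟩
    N ^ s * (N * ∑ Λ (λ ls → solved d ws ls * 𝟙 (solves? d ls (z , e))))
      ≡⟨ cong (λ n → N ^ s * (n * ∑ Λ (λ ls → solved d ws ls * 𝟙 (solves? d ls (z , e))))) (sym (length-upTo N)) ⟩
    N ^ s * (length (upTo N) * ∑ Λ (λ ls → solved d ws ls * 𝟙 (solves? d ls (z , e))))
      ≤⟨ *-monoʳ-≤ (N ^ s) (∑-coordinate (upTo N) c (solved d ws) (λ ls → 𝟙 (solves? d ls (z , e)))
           (solved-flat d ws c flat)
           (λ ls → ∑-at-most-one (λ a → solves? d (ls [ c ]≔ a) (z , e)) (upTo N) (Unique.upTo⁺ N)
                     (solves-unique d z e c z≢m ls))) ⟩
    N ^ s * (1 * ∑ Λ (solved d ws))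
      ≡⟨ cong (N ^ s *_) (*-identityˡ _) ⟩
    N ^ s * ∑ Λ (solved d ws)
      ≤⟨ solved-count d ws tri ⟩
    N ^ D ∎
    where
    open ≤-Reasoning
    shuffle : ∀ x y z → x * y * z ≡ y * (x * z)
    shuffle = solve-∀

  -- The hypothesis `room` is a union bound with cleared denominators: the bad λ form a fraction of
  -- at most `length Zs / N` on account of single equations, and of `n * length Ws / N ^ suc s` on
  -- account of systems.
  module Selection (s n : ℕ) (Zs : List (Vec ℕ D)) (Ws : List (Vec Shift (suc s)))
    (room : N ^ s * length Zs + n * length Ws < N ^ suc s) where

    -- With difference 0 and index part 0 an equation says λ·z = λ·`centre`, so `degenerate` is
    -- covered by the same count. For such a single equation, triangular means that `z` is not the
    -- centre.
    degenerate dependent : Vec ℕ D → ℕ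
    degenerate ls = ∑ Zs (λ z → 𝟙 (triangular? ((z , 0) ∷ [])) * solved 0 ((z , 0) ∷ []) ls)
    dependent ls = ∑ (upTo n) (λ d → ∑ Ws (λ ws → 𝟙 (triangular? ws) * solved d ws ls))

    weighted : ∀ {t} d (ws : Vec Shift t) →
               N ^ t * ∑ Λ (λ ls → 𝟙 (triangular? ws) * solved d ws ls) ≤ N ^ D
    weighted {t} d ws with triangular? ws
    ... | yes tri = subst (λ x → N ^ t * x ≤ N ^ D) (∑-cong Λ (λ ls → sym (*-identityˡ _))) (solved-count d ws tri)
    ... | no _    = subst (_≤ N ^ D) (sym (trans (cong (N ^ t *_) (trans (∑-const Λ 0) (*-zeroʳ (length Λ)))) (*-zeroʳ (N ^ t)))) z≤n

    many : {A : Set} (xs : List A) (q : ℕ) (f : A → Vec ℕ D → ℕ) {C : ℕ} →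
           (∀ x → q * ∑ Λ (f x) ≤ C) → q * ∑ Λ (λ ls → ∑ xs (λ x → f x ls)) ≤ length xs * C
    many xs q f {C} bound = begin
      q * ∑ Λ (λ ls → ∑ xs (λ x → f x ls)) ≡⟨ cong (q *_) (∑-swap Λ xs _) ⟩
      q * ∑ xs (λ x → ∑ Λ (f x))           ≡⟨ sym (∑-*ˡ xs q _) ⟩
      ∑ xs (λ x → q * ∑ Λ (f x))           ≤⟨ ∑-mono xs bound ⟩
      ∑ xs (λ _ → C)                       ≡⟨ ∑-const xs C ⟩
      length xs * C ∎
      where open ≤-Reasoning

    few-bad : ∑ Λ (λ ls → degenerate ls + dependent ls) < length Λ
    few-bad = *-cancelˡ-< (N ^ suc s) _ _ (begin-strict
      N ^ suc s * ∑ Λ (λ ls → degenerate ls + dependent ls)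
        ≡⟨ cong (N ^ suc s *_) (∑-+ Λ degenerate dependent) ⟩
      N ^ suc s * (∑ Λ degenerate + ∑ Λ dependent)
        ≡⟨ shuffle N (N ^ s) (∑ Λ degenerate) (∑ Λ dependent) ⟩
      N ^ s * (N ^ 1 * ∑ Λ degenerate) + N ^ suc s * ∑ Λ dependent
        ≤⟨ +-mono-≤ (*-monoʳ-≤ (N ^ s) (many Zs (N ^ 1) _ (λ z → weighted 0 ((z , 0) ∷ []))))
                    (many (upTo n) (N ^ suc s) _ (λ d → many Ws (N ^ suc s) _ (weighted d))) ⟩
      N ^ s * (length Zs * N ^ D) + length (upTo n) * (length Ws * N ^ D)
        ≡⟨ cong (λ x → N ^ s * (length Zs * N ^ D) + x * (length Ws * N ^ D)) (length-upTo n) ⟩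
      N ^ s * (length Zs * N ^ D) + n * (length Ws * N ^ D)
        ≡⟨ collect (N ^ s) (length Zs) (N ^ D) n (length Ws) ⟩
      (N ^ s * length Zs + n * length Ws) * N ^ D
        <⟨ *-monoˡ-< (N ^ D) {{m^n≢0 N D {{N≢0}}}} room ⟩
      N ^ suc s * N ^ D
        ≡⟨ cong (N ^ suc s *_) (sym length-Λ) ⟩
      N ^ suc s * length Λ ∎)
      where
      open ≤-Reasoning
      N≢0 : NonZero N
      N≢0 = ≢-nonZero λ N≡0 → n≮0 (subst (λ x → N ^ s * length Zs + n * length Ws < x * N ^ s) N≡0 room)
      shuffle : ∀ a b x y → a * b * (x + y) ≡ b * (a * 1 * x) + a * b * y
      shuffle = solve-∀
      collect : ∀ a b c d e → a * (b * c) + d * (e * c) ≡ (a * b + d * e) * c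
      collect = solve-∀

    generic : ∃[ ls ] (ls ∈ Λ
                     × (∀ {z} → z ∈ Zs → dot ls z ≡ dot ls centre → ∀ c → lookup z c ≡ m)
                     × (∀ {d ws} → d < n → ws ∈ Ws → Triangular ws → ¬ VAll (Solves d ls) ws))
    generic with ∑<length⇒zero Λ _ few-bad
    ... | ls , ls∈ , ≡0 = ls , ls∈ , proper , independent
      where
      conflict : ∀ {t d} (ws : Vec Shift t) → 𝟙 (triangular? ws) * solved d ws ls ≡ 0 →
                 Triangular ws → ¬ VAll (Solves d ls) ws
      conflict {d = d} ws eq tri all = 1≢0 (trans (sym (cong₂ _*_ (𝟙-yes (triangular? ws) tri) (solved-all d ws ls all))) eq)
        where
        1≢0 : ¬ (1 ≡ 0)
        1≢0 ()
      proper : ∀ {z} → z ∈ Zs → dot ls z ≡ dot ls centre → ∀ c → lookup z c ≡ m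
      proper {z} z∈ eq c with lookup z c ≟ m
      ... | yes z≡m = z≡m
      ... | no z≢m  = ⊥-elim (conflict {d = 0} ((z , 0) ∷ []) (∑≡0 Zs _ (m+n≡0⇒m≡0 (degenerate ls) ≡0) z∈)
                        (c , (z≢m , []ᵛ) , tt)
                        (trans (+-identityʳ _) (trans eq (sym (trans (cong (dot ls centre +_) (*-zeroʳ k)) (+-identityʳ _)))) ∷ᵛ []ᵛ))
      independent : ∀ {d ws} → d < n → ws ∈ Ws → Triangular ws → ¬ VAll (Solves d ls) ws
      independent {d} {ws} d<n ws∈ = conflict ws (∑≡0 Ws _ (∑≡0 (upTo n) _ (m+n≡0⇒n≡0 (degenerate ls) ≡0) (∈-upTo⁺ d<n)) ws∈)

-- Separated points, distinct values and spheres

vec-ext : ∀ {A : Set} {n} {x y : Vec A n} → (∀ i → lookup x i ≡ lookup y i) → x ≡ y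
vec-ext {x = x} {y} x≗y = trans (sym (tabulate∘lookup x)) (trans (tabulate-cong x≗y) (tabulate∘lookup y))

differ : ∀ {n} (x y : Vec ℕ n) → x ≢ y → ∃[ c ] (lookup x c ≢ lookup y c)
differ []       []       x≢y = ⊥-elim (x≢y refl)
differ (a ∷ x) (b ∷ y) x≢y with a ≟ b
... | no a≢b   = zero , a≢b
... | yes refl with differ x y (x≢y ∘ cong (a ∷_))
...   | c , ≢ = suc c , ≢

module Separation {A : Set} (D L : ℕ) .{{_ : NonZero L}} (key : A → Vec ℕ D) where

  -- The members of a pair differ at a coordinate at which the members of every later pair agree:
  -- exactly what makes the differences a triangular system.
  Separated : ∀ {s} → Vec (A × A) s → Set
  Separated []             = ⊤
  Separated ((p , q) ∷ ps) =
    ∃[ c ] (lookup (key p) c ≢ lookup (key q) c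
          × VAll (λ (p′ , q′) → lookup (key p′) c ≡ lookup (key q′) c) ps) × Separated ps

  -- Pass to the largest class of points sharing the coordinate that separated the previous pair.
  separated-pairs : ∀ s (Y : List A) → Unique Y →
                    (∀ {p q} → p ∈ Y → q ∈ Y → key p ≡ key q → p ≡ q) →
                    (∀ {p} → p ∈ Y → ∀ c → lookup (key p) c < L) →
                    L ^ s < length Y →
                    ∃[ ps ] (VAll (λ (p , q) → p ∈ Y × q ∈ Y) ps × Separated {suc s} ps)
  separated-pairs s [] _ _ _ ()
  separated-pairs s (p ∷ []) _ _ _ lt = ⊥-elim (<⇒≱ lt (m^n>0 L s))
  separated-pairs s (p ∷ q ∷ Y) ((p≢q ∷ _) ∷ _) inj _ lt
    with differ (key p) (key q) (p≢q ∘ inj (here refl) (there (here refl)))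
  separated-pairs zero (p ∷ q ∷ Y) _ inj _ lt | c , ≢ =
    (p , q) ∷ [] , (here refl , there (here refl)) ∷ᵛ []ᵛ , c , (≢ , []ᵛ) , tt
  separated-pairs (suc s) Y₀@(p ∷ q ∷ _) uniq inj box lt | c , ≢
    with pigeonhole Y₀ L (λ y → lookup (key y) c) (λ y∈ → box y∈ c)
  ... | v , le
    with separated-pairs s (filter (λ y → lookup (key y) c ≟ v) Y₀)
           (Unique.filter⁺ (λ y → lookup (key y) c ≟ v) uniq)
           (λ p∈ q∈ → inj (sub p∈) (sub q∈)) (λ p∈ → box (sub p∈))
           (*-cancelˡ-< L _ _ (<-≤-trans lt le))
    where
    sub : ∀ {y} → y ∈ filter (λ y → lookup (key y) c ≟ v) Y₀ → y ∈ Y₀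
    sub = proj₁ ∘ ∈-filter⁻ (λ y → lookup (key y) c ≟ v) {xs = Y₀}
  ...   | ps , ps∈ , sep =
    (p , q) ∷ ps
    , (here refl , there (here refl)) ∷ᵛ VecAll.map (λ (a , b) → proj₁ (back a) , proj₁ (back b)) ps∈
    , c , (≢ , VecAll.map (λ (a , b) → trans (proj₂ (back a)) (sym (proj₂ (back b)))) ps∈) , sep
    where
    back : ∀ {y} → y ∈ filter (λ y → lookup (key y) c ≟ v) Y₀ → y ∈ Y₀ × lookup (key y) c ≡ v
    back = ∈-filter⁻ (λ y → lookup (key y) c ≟ v) {xs = Y₀}

∑-filter≤ : {A : Set} {P : A → Set} (P? : ∀ x → Dec (P x)) (xs : List A) (f : A → ℕ) →
            ∑ (filter P? xs) f ≤ ∑ xs f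
∑-filter≤ P? []       f = z≤n
∑-filter≤ P? (x ∷ xs) f with P? x
... | yes _ = +-monoʳ-≤ (f x) (∑-filter≤ P? xs f)
... | no _  = ≤-trans (∑-filter≤ P? xs f) (m≤n+m _ (f x))

length-filter-split : {A : Set} {P : A → Set} (P? : ∀ x → Dec (P x)) (xs : List A) →
                      length xs ≡ ∑ xs (𝟙 ∘ P?) + length (filter (¬? ∘ P?) xs)
length-filter-split P? []       = refl
length-filter-split P? (x ∷ xs) with P? x
... | yes _ = cong suc (length-filter-split P? xs)
... | no _  = trans (cong suc (length-filter-split P? xs)) (sym (+-suc _ _))

-- Greedy choice: take the first entry and delete all its copies. Each round uses up at most `M`
-- entries.
distinct-sublist : {A : Set} (_≟ᴬ_ : DecidableEquality A) (M : ℕ) → 0 < M → (h : ℕ) (xs : List A) →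
                   (∀ v → ∑ xs (λ x → 𝟙 (v ≟ᴬ x)) ≤ M) → h * M ≤ length xs →
                   ∃[ ys ] (Unique ys × length ys ≡ h × (∀ {y} → y ∈ ys → y ∈ xs))
distinct-sublist _≟ᴬ_ M M>0 zero    xs few le = [] , [] , refl , λ ()
distinct-sublist _≟ᴬ_ M M>0 (suc h) [] few le = ⊥-elim (<⇒≱ M>0 (≤-trans (m≤m+n M _) le))
distinct-sublist {A} _≟ᴬ_ M M>0 (suc h) xs@(x ∷ _) few le
  with distinct-sublist _≟ᴬ_ M M>0 h rest
         (λ v → ≤-trans (∑-filter≤ (¬? ∘ (x ≟ᴬ_)) xs _) (few v))
         (+-cancelˡ-≤ M _ _ (≤-trans le (≤-trans (≤-reflexive (length-filter-split (x ≟ᴬ_) xs))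
                                                  (+-monoˡ-≤ _ (few x)))))
  where
  rest : List A
  rest = filter (¬? ∘ (x ≟ᴬ_)) xs
... | ys , uniq , len , sub =
  x ∷ ys , All.tabulate (λ y∈ → proj₂ (back y∈)) ∷ uniq , cong suc len ,
  λ { (here refl) → here refl ; (there y∈) → proj₁ (back y∈) }
  where
  back : ∀ {y} → y ∈ ys → y ∈ xs × x ≢ y
  back = ∈-filter⁻ (¬? ∘ (x ≟ᴬ_)) {xs = xs} ∘ sub

dot-+ : ∀ {D} (ls x y : Vec ℕ D) → dot ls (zipWith _+_ x y) ≡ dot ls x + dot ls y
dot-+ []       []      []      = refl
dot-+ (l ∷ ls) (a ∷ x) (b ∷ y) =
  trans (cong (l * (a + b) +_) (dot-+ ls x y)) (shuffle l a b (dot ls x) (dot ls y))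
  where
  shuffle : ∀ l a b p q → l * (a + b) + (p + q) ≡ l * a + p + (l * b + q)
  shuffle = solve-∀

dot-≤ : ∀ {D} (ls x : Vec ℕ D) {N L} → (∀ c → lookup ls c ≤ N) → (∀ c → lookup x c ≤ L) →
        dot ls x ≤ D * (N * L)
dot-≤ []       []      _  _ = z≤n
dot-≤ (l ∷ ls) (a ∷ x) ls≤N x≤L =
  +-mono-≤ (*-mono-≤ (ls≤N zero) (x≤L zero)) (dot-≤ ls x (ls≤N ∘ suc) (x≤L ∘ suc))

-- The excess is t = 2 (b - a)^2. Keeping only that its vanishing forces `a ≡ b` lets the excesses
-- of all coordinates be added.
square-gap : ∀ a b c → a + c ≡ b + b → ∃[ t ] (a * a + c * c ≡ b * b + b * b + t × (t ≡ 0 → a ≡ b))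
square-gap a b c eq = [ below a b c eq , above ]′ (≤-total a b)
  where
  below : ∀ a b c → a + c ≡ b + b → a ≤ b → ∃[ t ] (a * a + c * c ≡ b * b + b * b + t × (t ≡ 0 → a ≡ b))
  below a b c eq a≤b with m≤n⇒∃[o]m+o≡n a≤b
  ... | o , refl with +-cancelˡ-≡ a _ _ (trans eq (shuffle a o))
    where
    shuffle : ∀ a o → a + o + (a + o) ≡ a + (a + (o + o))
    shuffle = solve-∀
  ...   | refl = 2 * (o * o) , expand a o , λ ≡0 → sym (trans (cong (a +_) (root o ≡0)) (+-identityʳ a))
    where
    expand : ∀ a o → a * a + (a + (o + o)) * (a + (o + o)) ≡ (a + o) * (a + o) + (a + o) * (a + o) + 2 * (o * o)
    expand = solve-∀
    root : ∀ o → 2 * (o * o) ≡ 0 → o ≡ 0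
    root zero    _ = refl
    root (suc _) ()
  above : b ≤ a → ∃[ t ] (a * a + c * c ≡ b * b + b * b + t × (t ≡ 0 → a ≡ b))
  above b≤a with below c b a (trans (+-comm c a) eq) (+-cancelˡ-≤ b _ _ (subst (b + c ≤_) eq (+-monoˡ-≤ c b≤a)))
  ... | t , gap , z = t , trans (+-comm (a * a) (c * c)) gap ,
        λ ≡0 → +-cancelʳ-≡ c a b (trans eq (cong (b +_) (sym (z ≡0))))

norm-gap : ∀ {D} (x y z : Vec ℕ D) → (∀ c → lookup x c + lookup z c ≡ lookup y c + lookup y c) →
           ∃[ t ] (dot x x + dot z z ≡ dot y y + dot y y + t × (t ≡ 0 → x ≡ y))
norm-gap []      []      []      _   = 0 , refl , λ _ → refl
norm-gap (a ∷ x) (b ∷ y) (c ∷ z) mid with square-gap a b c (mid zero) | norm-gap x y z (mid ∘ suc)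
... | t , gap , a≡b | t′ , gap′ , x≡y = t + t′ ,
  trans (regroup (a * a) (dot x x) (c * c) (dot z z)) (trans (cong₂ _+_ gap gap′)
    (regroup′ (b * b) (dot y y) t t′)) ,
  λ ≡0 → cong₂ _∷_ (a≡b (m+n≡0⇒m≡0 t ≡0)) (x≡y (m+n≡0⇒n≡0 t ≡0))
  where
  regroup : ∀ p q r s → p + q + (r + s) ≡ p + r + (q + s)
  regroup = solve-∀
  regroup′ : ∀ p q t u → p + p + t + (q + q + u) ≡ p + q + (p + q) + (t + u)
  regroup′ = solve-∀

-- Strict convexity: with three equal norms the total excess is 0.
sphere-convex : ∀ {D} (x y z : Vec ℕ D) {ρ} → dot x x ≡ ρ → dot y y ≡ ρ → dot z z ≡ ρ →
                (∀ c → lookup x c + lookup z c ≡ lookup y c + lookup y c) → x ≡ y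
sphere-convex x y z nx ny nz mid with norm-gap x y z mid
... | t , gap , x≡y = x≡y (sym (+-cancelˡ-≡ (dot y y + dot y y) _ _
  (trans (+-identityʳ _) (trans (cong₂ _+_ (trans ny (sym nx)) (trans ny (sym nz))) gap))))

module Sphere (D L : ℕ) .{{_ : NonZero L}} where

  box : List (Vec ℕ D)
  box = vecs (upTo L) D

  ∈-box : ∀ {x} → x ∈ box → ∀ c → lookup x c < L
  ∈-box {x} x∈ c = ∈-upTo⁻ (∈-vecs⁻ x x∈ c)

  sphere : ℕ → List (Vec ℕ D)
  sphere ρ = filter (λ x → dot x x ≟ ρ) box

  -- As in Behrend's construction, the squared norm takes at most `suc (D * (L * L))` values on the
  -- box, so some sphere has its share of the points.
  large-sphere : ∃[ ρ ] (L ^ D ≤ suc (D * (L * L)) * length (sphere ρ))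
  large-sphere with pigeonhole box (suc (D * (L * L))) (λ x → dot x x)
                      (λ {x} x∈ → s≤s (dot-≤ x x (<⇒≤ ∘ ∈-box x∈) (<⇒≤ ∘ ∈-box x∈)))
  ... | ρ , le = ρ , ≤-trans (≤-reflexive (sym (trans (length-vecs (upTo L) D) (cong (_^ D) (length-upTo L))))) le

  sphere-unique : ∀ ρ → Unique (sphere ρ)
  sphere-unique ρ = Unique.filter⁺ (λ x → dot x x ≟ ρ) (vecs-unique D (Unique.upTo⁺ L))

  ∈-sphere : ∀ {ρ x} → x ∈ sphere ρ → x ∈ box × dot x x ≡ ρ
  ∈-sphere {ρ} = ∈-filter⁻ (λ x → dot x x ≟ ρ) {xs = box}

-- The colouring

toℕ-clip : ∀ {V} (v : Fin V) {m} → m < V → toℕ (clip v m) ≡ m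
toℕ-clip {V} v {m} m<V with m <? V
... | yes p = Fin.toℕ-fromℕ< p
... | no ¬p = ⊥-elim (¬p m<V)

does-true : {P : Set} (P? : Dec P) → does P? ≡ true → P
does-true (yes p) _ = p
does-true (no _)  ()

module Construction (D L k n N s b h : ℕ) .{{_ : NonZero L}} where

  m : ℕ
  -- This bounds the entries of a sum of two points of the box, so one centre serves both for
  -- differences x - y and for second differences x₁ + x₃ - 2x₂.
  m = L + L

  open Sphere D L
  open Generic D m k N

  differences : List (Vec ℕ D)
  differences = vecs (upTo (suc (m + m))) D

  shifts : List Shift
  shifts = cartesianProduct differences (upTo (suc (k + k)))

  systems : List (Vec Shift (suc s))
  systems = vecs shifts (suc s)

  V : ℕ
  -- Large enough to contain every p + λ·x with `p ≤ n` and `x` in the box.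
  V = suc (n + D * (N * L))

  module _
    (room : N ^ s * length differences + suc n * length systems < N ^ suc s)
    (mass : suc (D * (L * L)) * (h * L ^ s) ≤ k * L ^ D)
    (k≥2 : 2 ≤ k) (h>0 : 0 < h)
    (rare₂ : 3 * (2 + b) * (length differences * 4 * 2 ^ 2) ≤ (1 + b) ^ 2)
    (rare₃ : 3 * (2 + b) * (V * (length differences * 2) * 2 ^ 3) ≤ (1 + b) ^ 3)
    (rareᵇ : 3 * (2 + b) * (suc n * suc n * b ^ h) ≤ (1 + b) ^ h)
    where

    abstract
      selection : ∃[ ls ] (ls ∈ Λ
                     × (∀ {z} → z ∈ differences → dot ls z ≡ dot ls centre → ∀ c → lookup z c ≡ m)
                     × (∀ {d ws} → d < suc n → ws ∈ systems → Triangular ws → ¬ VAll (Solves d ls) ws))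
      selection = Selection.generic s (suc n) differences systems room

      large : ∃[ ρ ] (L ^ D ≤ suc (D * (L * L)) * length (sphere ρ))
      large = large-sphere

    ls : Vec ℕ D
    ls = proj₁ selection

    ls∈Λ : ls ∈ Λ
    ls∈Λ = proj₁ (proj₂ selection)

    proper : ∀ {z} → z ∈ differences → dot ls z ≡ dot ls centre → ∀ c → lookup z c ≡ m
    proper = proj₁ (proj₂ (proj₂ selection))

    independent : ∀ {d ws} → d < suc n → ws ∈ systems → Triangular ws → ¬ VAll (Solves d ls) ws
    independent = proj₂ (proj₂ (proj₂ selection))

    S : List (Vec ℕ D)
    S = sphere (proj₁ large)

    S-box : ∀ {x} → x ∈ S → ∀ c → lookup x c < L
    S-box x∈ = ∈-box (proj₁ (∈-sphere x∈))

    S<V : ∀ {p x} → p ≤ n → x ∈ S → p + dot ls x < V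
    S<V {p} {x} p≤n x∈ = s≤s (+-mono-≤ p≤n (dot-≤ ls x (λ c → <⇒≤ (∈-upTo⁻ (∈-vecs⁻ ls ls∈Λ c))) (<⇒≤ ∘ S-box x∈)))

    place : ℕ → Fin V
    place = clip zero

    κ : ℕ
    κ = dot ls centre

    Δ : List ℕ
    Δ = map (dot ls) differences

    -- y − x + centre, for x ≤ centre
    _⊟_ : Vec ℕ D → Vec ℕ D → Vec ℕ D
    y ⊟ x = tabulate λ c → lookup y c + m ∸ lookup x c

    ⊟-spec : ∀ y x → (∀ c → lookup x c ≤ m) → ∀ c → lookup (y ⊟ x) c + lookup x c ≡ lookup y c + m
    ⊟-spec y x x≤m c = trans (cong (_+ lookup x c) (lookup∘tabulate _ c))
                             (m∸n+n≡m (≤-trans (x≤m c) (m≤n+m m (lookup y c))))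

    ⊟-dot : ∀ y x → (∀ c → lookup x c ≤ m) → dot ls (y ⊟ x) + dot ls x ≡ dot ls y + κ
    ⊟-dot y x x≤m = trans (sym (dot-+ ls (y ⊟ x) x)) (trans (cong (dot ls) (vec-ext pointwise)) (dot-+ ls y centre))
      where
      pointwise : ∀ c → lookup (zipWith _+_ (y ⊟ x) x) c ≡ lookup (zipWith _+_ y centre) c
      pointwise c = begin
        lookup (zipWith _+_ (y ⊟ x) x) c ≡⟨ lookup-zipWith _+_ c (y ⊟ x) x ⟩
        lookup (y ⊟ x) c + lookup x c    ≡⟨ ⊟-spec y x x≤m c ⟩
        lookup y c + m                   ≡⟨ cong (lookup y c +_) (sym (lookup-replicate c m)) ⟩
        lookup y c + lookup centre c     ≡⟨ sym (lookup-zipWith _+_ c y centre) ⟩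
        lookup (zipWith _+_ y centre) c  ∎
        where open ≡-Reasoning

    ⊟-∈ : ∀ y x → (∀ c → lookup y c ≤ m) → y ⊟ x ∈ differences
    ⊟-∈ y x y≤m = ∈-vecs⁺ (y ⊟ x) λ c → ∈-upTo⁺ (s≤s (≤-trans (≤-reflexive (lookup∘tabulate _ c))
                    (≤-trans (m∸n≤m _ (lookup x c)) (+-monoˡ-≤ m (y≤m c)))))

    ⊟-≡m : ∀ y x → (∀ c → lookup x c ≤ m) → ∀ c → lookup (y ⊟ x) c ≡ m → lookup y c ≡ lookup x c
    ⊟-≡m y x x≤m c eq = +-cancelʳ-≡ m _ _ (trans (sym (⊟-spec y x x≤m c)) (trans (cong (_+ lookup x c) eq) (+-comm m _)))

    ⊟-≡m⁻ : ∀ y x → (∀ c → lookup x c ≤ m) → ∀ c → lookup y c ≡ lookup x c → lookup (y ⊟ x) c ≡ m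
    ⊟-≡m⁻ y x x≤m c eq = +-cancelʳ-≡ (lookup x c) _ _ (trans (⊟-spec y x x≤m c) (trans (cong (_+ m) eq) (+-comm _ m)))

    S≤m : ∀ {x} → x ∈ S → ∀ c → lookup x c ≤ m
    S≤m x∈ c = ≤-trans (<⇒≤ (S-box x∈ c)) (m≤m+n L L)

    module Progression (a d : ℕ) (d≥1 : 1 ≤ d) (d≤n : d ≤ n) (inside : ∀ i → i < k → a + i * d ≤ n) where

      Index : Set
      Index = ℕ × Vec ℕ D

      indices : List Index
      indices = cartesianProduct (upTo k) S

      value : Index → ℕ
      value (j , x) = a + j * d + dot ls x

      index∈ : ∀ {p} → p ∈ indices → proj₁ p < k × proj₂ p ∈ S
      index∈ p∈ with ∈-cartesianProduct⁻ (upTo k) S p∈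
      ... | j∈ , x∈ = ∈-upTo⁻ j∈ , x∈

      value<V : ∀ {p} → p ∈ indices → value p < V
      value<V p∈ = S<V (inside _ (proj₁ (index∈ p∈))) (proj₂ (index∈ p∈))

      open Separation {Index} D L proj₂

      shift : Index × Index → Shift
      shift ((i , x) , (j , y)) = x ⊟ y , i + k ∸ j

      Same : Index × Index → Set
      Same (p , q) = (p ∈ indices × q ∈ indices) × value p ≡ value q

      shift∈ : ∀ {pq} → Same pq → shift pq ∈ shifts
      shift∈ {(i , x) , (j , y)} ((p∈ , q∈) , _) = ∈-cartesianProduct⁺
        (⊟-∈ x y (S≤m (proj₂ (index∈ p∈))))
        (∈-upTo⁺ (s≤s (≤-trans (m∸n≤m _ j) (+-monoˡ-≤ k (<⇒≤ (proj₁ (index∈ p∈)))))))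

      shift-solves : ∀ {pq} → Same pq → Solves d ls (shift pq)
      shift-solves {(i , x) , (j , y)} ((p∈ , q∈) , eq) = +-cancelʳ-≡ (dot ls y + j * d) _ _ (begin
        dot ls (x ⊟ y) + e * d + (dot ls y + j * d)   ≡⟨ regroup (dot ls (x ⊟ y)) e d (dot ls y) j ⟩
        dot ls (x ⊟ y) + dot ls y + (e + j) * d       ≡⟨ cong₂ (λ u v → u + v * d) (⊟-dot x y (S≤m (proj₂ (index∈ q∈))))
                                                          (m∸n+n≡m (≤-trans (<⇒≤ (proj₁ (index∈ q∈))) (m≤n+m k i))) ⟩
        dot ls x + κ + (i + k) * d                    ≡⟨ regroup′ (dot ls x) κ i k d ⟩
        i * d + dot ls x + (κ + k * d)                ≡⟨ cong (_+ (κ + k * d)) (+-cancelˡ-≡ a _ _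
                                                          (trans (sym (+-assoc a (i * d) _)) (trans eq (+-assoc a (j * d) _)))) ⟩
        j * d + dot ls y + (κ + k * d)                ≡⟨ regroup″ (j * d) (dot ls y) (κ + k * d) ⟩
        κ + k * d + (dot ls y + j * d)                ∎)
        where
        open ≡-Reasoning
        e = i + k ∸ j
        regroup : ∀ z e d y j → z + e * d + (y + j * d) ≡ z + y + (e + j) * d
        regroup = solve-∀
        regroup′ : ∀ x κ i k d → x + κ + (i + k) * d ≡ i * d + x + (κ + k * d)
        regroup′ = solve-∀
        regroup″ : ∀ x y z → x + y + z ≡ z + (y + x)
        regroup″ = solve-∀

      triangular : ∀ {t} (ps : Vec (Index × Index) t) → VAll Same ps → Separated ps → Triangular (Vec.map shift ps)
      triangular []                           []ᵛ                          _ = tt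
      triangular (((i , x) , (j , y)) ∷ ps) (((_ , q∈) , _) ∷ᵛ same) (c , (x≢y , agree) , sep) =
        c , ((λ ≡m → x≢y (⊟-≡m x y (S≤m (proj₂ (index∈ q∈))) c ≡m)) , flat ps same agree) , triangular ps same sep
        where
        flat : ∀ {t} (ps : Vec (Index × Index) t) → VAll Same ps →
               VAll (λ (p′ , q′) → lookup (proj₂ p′) c ≡ lookup (proj₂ q′) c) ps →
               VAll (λ w → lookup (proj₁ w) c ≡ m) (Vec.map shift ps)
        flat []                       []ᵛ               []ᵛ        = []ᵛ
        flat (((_ , x) , (_ , y)) ∷ ps) (((_ , q∈) , _) ∷ᵛ same) (eq ∷ᵛ eqs) =
          ⊟-≡m⁻ x y (S≤m (proj₂ (index∈ q∈))) c eq ∷ᵛ flat ps same eqs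

      map-all : ∀ {t} {P : Shift → Set} (ps : Vec (Index × Index) t) → (∀ {pq} → Same pq → P (shift pq)) →
                VAll Same ps → VAll P (Vec.map shift ps)
      map-all []       f []ᵛ        = []ᵛ
      map-all (_ ∷ ps) f (s ∷ᵛ ss) = f s ∷ᵛ map-all ps f ss

      fibre : Fin V → List Index
      fibre v = filter (λ p → v Fin.≟ place (value p)) indices

      -- A larger fibre would contain `suc s` separated pairs of indices with equal value, and their
      -- shifts would form a triangular system solved by λ. Keys are injective on a fibre because
      -- `x` and the value determine the index, `d` being positive.
      fibre-small : ∀ v → length (fibre v) ≤ L ^ s
      fibre-small v = ≮⇒≥ λ lt → conflict (separated-pairs s (fibre v)
          (Unique.filter⁺ _ (Unique.cartesianProduct⁺ (Unique.upTo⁺ k) (sphere-unique _)))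
          (λ p∈ q∈ → same-key (fibre∈ p∈) (fibre∈ q∈))
          (λ p∈ → S-box (proj₂ (index∈ (proj₁ (fibre∈ p∈))))) lt)
        where
        fibre∈ : ∀ {p} → p ∈ fibre v → p ∈ indices × value p ≡ toℕ v
        fibre∈ p∈ with ∈-filter⁻ (λ p → v Fin.≟ place (value p)) {xs = indices} p∈
        ... | p∈ , eq = p∈ , trans (sym (toℕ-clip zero (value<V p∈))) (cong toℕ (sym eq))
        same-key : ∀ {p q} → p ∈ indices × value p ≡ toℕ v → q ∈ indices × value q ≡ toℕ v →
                   proj₂ p ≡ proj₂ q → p ≡ q
        same-key {i , x} {j , _} (_ , eqp) (_ , eqq) refl = cong (_, x)
          (*-cancelʳ-≡ i j d {{>-nonZero d≥1}} (+-cancelˡ-≡ a _ _ (+-cancelʳ-≡ (dot ls x) _ _ (trans eqp (sym eqq)))))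
        conflict : ¬ (∃[ ps ] (VAll (λ (p , q) → p ∈ fibre v × q ∈ fibre v) ps × Separated {suc s} ps))
        conflict (ps , ps∈ , sep) = independent (s≤s d≤n)
          (∈-vecs⁺ (Vec.map shift ps) (VecAllₚ.lookup⁺ (map-all {P = _∈ shifts} ps shift∈ same)))
          (triangular ps same sep) (map-all ps shift-solves same)
          where
          same : VAll Same ps
          same = VecAll.map (λ (p∈ , q∈) → (proj₁ (fibre∈ p∈) , proj₁ (fibre∈ q∈)) ,
                                           trans (proj₂ (fibre∈ p∈)) (sym (proj₂ (fibre∈ q∈)))) ps∈

      many-indices : h * L ^ s ≤ length (map (place ∘ value) indices)
      many-indices = *-cancelˡ-≤ C {{_}} (begin
        C * (h * L ^ s)              ≤⟨ mass ⟩
        k * L ^ D                    ≤⟨ *-monoʳ-≤ k (proj₂ large) ⟩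
        k * (C * length S)           ≡⟨ swap k C (length S) ⟩
        C * (k * length S)           ≡⟨ cong (λ z → C * (z * length S)) (sym (length-upTo k)) ⟩
        C * (length (upTo k) * length S) ≡⟨ cong (C *_) (sym (length-cartesianProductWith _,_ (upTo k) S)) ⟩
        C * length indices           ≡⟨ cong (C *_) (sym (length-map (place ∘ value) indices)) ⟩
        C * length (map (place ∘ value) indices) ∎)
        where
        open ≤-Reasoning
        C = suc (D * (L * L))
        swap : ∀ x y z → x * (y * z) ≡ y * (x * z)
        swap = solve-∀

      abstract
        hits : ∃[ ys ] (Unique ys × length ys ≡ h × (∀ {y} → y ∈ ys → y ∈ map (place ∘ value) indices))
        hits = distinct-sublist Fin._≟_ (L ^ s) (m^n>0 L s) h (map (place ∘ value) indices)
          (λ v → ≤-trans (≤-reflexive (trans (∑-map (place ∘ value) indices (λ x → 𝟙 (v Fin.≟ x)))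
                    (sym (length-filter-∑ (λ p → v Fin.≟ place (value p)) indices)))) (fibre-small v))
          many-indices

    Valid : ℕ × ℕ → Set
    Valid (a , d) = 1 ≤ d × d ≤ n × (∀ {i} → i < k → a + i * d ≤ n)

    valid : ∀ {a d} → 1 ≤ d → (∀ i → i < k → a + i * d ≤ n) → Valid (a , d)
    valid {a} {d} d≥1 inside =
      d≥1 , ≤-trans (m≤n+m d a) (subst (λ z → a + z ≤ n) (*-identityˡ d) (inside 1 k≥2)) , inside _

    valid? : ∀ ad → Dec (Valid ad)
    valid? (a , d) = (1 ≤? d) ×-dec ((d ≤? n) ×-dec allUpTo? (λ i → a + i * d ≤? n) k)

    family : ℕ × ℕ → List (List (Fin V))
    family (a , d) with valid? (a , d)
    ... | yes (d≥1 , d≤n , inside) = proj₁ (Progression.hits a d d≥1 d≤n (λ i → inside)) ∷ []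
    ... | no _ = []

    family-size : ∀ ad → length (family ad) ≤ 1
    family-size (a , d) with valid? (a , d)
    ... | yes _ = ≤-refl
    ... | no _  = z≤n

    grid : List (ℕ × ℕ)
    grid = cartesianProduct (upTo (suc n)) (upTo (suc n))

    F : List (List (Fin V))
    F = concatMap family grid

    F-size : length F ≤ suc n * suc n
    F-size = ≤-trans (length-concatMap≤ family grid family-size) (≤-reflexive
      (trans (*-identityʳ _) (trans (length-cartesianProductWith _,_ (upTo (suc n)) (upTo (suc n)))
        (cong₂ _*_ (length-upTo (suc n)) (length-upTo (suc n))))))

    family-shape : ∀ ad {e} → e ∈ family ad → Unique e × length e ≡ h
    family-shape (a , d) e∈ with valid? (a , d)
    family-shape (a , d) (here refl) | yes (d≥1 , d≤n , inside)
      with Progression.hits a d d≥1 d≤n (λ i → inside)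
    ... | _ , uniq , len , _ = uniq , len
    family-shape (a , d) () | no _

    F-shape : ∀ {e} → e ∈ F → Unique e × length e ≡ h
    F-shape e∈ with find (∈-concatMap⁻ family {xs = grid} e∈)
    ... | ad , _ , e∈ad = family-shape ad e∈ad

    length-Δ : length Δ ≡ length differences
    length-Δ = length-map (dot ls) differences

    abstract
      random-set : ∃[ ω ] ((∀ u₁ u₂ u₃ → lookup ω u₁ ≡ true → lookup ω u₂ ≡ true → lookup ω u₃ ≡ true →
                               ∀ {δ} → δ ∈ Δ → toℕ u₁ + toℕ u₃ + κ ≡ toℕ u₂ + toℕ u₂ + δ → u₁ ≡ u₂ × u₂ ≡ u₃)
                          × (∀ {e} → e ∈ F → ∃[ u ] (u ∈ e × lookup ω u ≡ true)))
      random-set = Hitting.hitting-set V κ b h Δ F F-shape h>0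
        (subst (λ l → 3 * (2 + b) * (l * 4 * 2 ^ 2) ≤ (1 + b) ^ 2) (sym length-Δ) rare₂)
        (subst (λ l → 3 * (2 + b) * (V * (l * 2) * 2 ^ 3) ≤ (1 + b) ^ 3) (sym length-Δ) rare₃)
        (≤-trans (*-monoʳ-≤ (3 * (2 + b)) (*-monoˡ-≤ (b ^ h) F-size)) rareᵇ)

    ω : Vec Bool V
    ω = proj₁ random-set

    red? : ∀ p → Dec _
    red? p = any? (λ x → lookup ω (place (p + dot ls x)) Bool.≟ true) S

    colouring : Colouring
    colouring p = does (red? p)

    red-witness : ∀ {p} → p ≤ n → colouring p ≡ true →
                  ∃[ x ] (x ∈ S × ∃[ u ] (lookup ω u ≡ true × toℕ u ≡ p + dot ls x))
    red-witness {p} p≤n red with find (does-true (red? p) red)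
    ... | x , x∈ , lit = x , x∈ , place (p + dot ls x) , lit , toℕ-clip zero (S<V p≤n x∈)

    infixl 6 _⊕_

    _⊕_ : Vec ℕ D → Vec ℕ D → Vec ℕ D
    _⊕_ = zipWith _+_

    ⊕≤m : ∀ {x x′} → x ∈ S → x′ ∈ S → ∀ c → lookup (x ⊕ x′) c ≤ m
    ⊕≤m {x} {x′} x∈ x′∈ c = ≤-trans (≤-reflexive (lookup-zipWith _+_ c x x′))
                              (+-mono-≤ (<⇒≤ (S-box x∈ c)) (<⇒≤ (S-box x′∈ c)))

    -- The witnesses p + λ·x in U satisfy a forbidden relation, hence they coincide. Then λ
    -- annihilates x₁ + x₃ - 2x₂, so by genericity x₂ is the midpoint of x₁ and x₃, the sphere gives
    -- x₁ = x₂, and p₁ = p₂ follows.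
    no-red-triple : ∀ p₁ p₂ p₃ → p₁ ≤ n → p₂ ≤ n → p₃ ≤ n → p₁ + p₃ ≡ p₂ + p₂ →
                    colouring p₁ ≡ true → colouring p₂ ≡ true → colouring p₃ ≡ true → p₁ ≡ p₂
    no-red-triple p₁ p₂ p₃ ≤n₁ ≤n₂ ≤n₃ mid r₁ r₂ r₃
      with red-witness ≤n₁ r₁ | red-witness ≤n₂ r₂ | red-witness ≤n₃ r₃
    ... | x₁ , x₁∈ , u₁ , l₁ , e₁ | x₂ , x₂∈ , u₂ , l₂ , e₂ | x₃ , x₃∈ , u₃ , l₃ , e₃
      with proj₁ (proj₂ random-set) u₁ u₂ u₃ l₁ l₂ l₃ {dot ls z} (∈-map⁺ (dot ls) z∈) relation
      where
      y = x₁ ⊕ x₃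
      y′ = x₂ ⊕ x₂
      z = y ⊟ y′
      z∈ : z ∈ differences
      z∈ = ⊟-∈ y y′ (⊕≤m x₁∈ x₃∈)
      dot-z : dot ls z + (dot ls x₂ + dot ls x₂) ≡ dot ls x₁ + dot ls x₃ + κ
      dot-z = trans (cong (dot ls z +_) (sym (dot-+ ls x₂ x₂)))
                (trans (⊟-dot y y′ (⊕≤m x₂∈ x₂∈)) (cong (_+ κ) (dot-+ ls x₁ x₃)))
      relation : toℕ u₁ + toℕ u₃ + κ ≡ toℕ u₂ + toℕ u₂ + dot ls z
      relation = begin
        toℕ u₁ + toℕ u₃ + κ                              ≡⟨ cong₂ (λ a b → a + b + κ) e₁ e₃ ⟩
        p₁ + dot ls x₁ + (p₃ + dot ls x₃) + κ            ≡⟨ regroup p₁ (dot ls x₁) p₃ (dot ls x₃) κ ⟩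
        p₁ + p₃ + (dot ls x₁ + dot ls x₃ + κ)            ≡⟨ cong₂ _+_ mid (sym dot-z) ⟩
        p₂ + p₂ + (dot ls z + (dot ls x₂ + dot ls x₂))   ≡⟨ regroup′ p₂ (dot ls z) (dot ls x₂) ⟩
        p₂ + dot ls x₂ + (p₂ + dot ls x₂) + dot ls z     ≡⟨ cong (λ a → a + a + dot ls z) (sym e₂) ⟩
        toℕ u₂ + toℕ u₂ + dot ls z                       ∎
        where
        open ≡-Reasoning
        regroup : ∀ a b c d e → a + b + (c + d) + e ≡ a + c + (b + d + e)
        regroup = solve-∀
        regroup′ : ∀ a b c → a + a + (b + (c + c)) ≡ a + c + (a + c) + b
        regroup′ = solve-∀
    ... | refl , refl = +-cancelʳ-≡ (dot ls x₁) _ _ (trans (sym e₁) (trans e₂ (cong (λ x → p₂ + dot ls x) (sym x₁≡x₂))))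
      where
      y = x₁ ⊕ x₃
      y′ = x₂ ⊕ x₂
      dots : dot ls x₁ + dot ls x₃ ≡ dot ls x₂ + dot ls x₂
      dots = +-cancelˡ-≡ (p₁ + p₃) _ _ (begin
        p₁ + p₃ + (dot ls x₁ + dot ls x₃)          ≡⟨ regroup p₁ p₃ (dot ls x₁) (dot ls x₃) ⟩
        p₁ + dot ls x₁ + (p₃ + dot ls x₃)          ≡⟨ cong₂ _+_ (trans (sym e₁) e₂) (trans (sym e₃) e₂) ⟩
        p₂ + dot ls x₂ + (p₂ + dot ls x₂)          ≡⟨ sym (regroup p₂ p₂ (dot ls x₂) (dot ls x₂)) ⟩
        p₂ + p₂ + (dot ls x₂ + dot ls x₂)          ≡⟨ cong (_+ (dot ls x₂ + dot ls x₂)) (sym mid) ⟩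
        p₁ + p₃ + (dot ls x₂ + dot ls x₂)          ∎)
        where
        open ≡-Reasoning
        regroup : ∀ a b c d → a + b + (c + d) ≡ a + c + (b + d)
        regroup = solve-∀
      central : dot ls (y ⊟ y′) ≡ κ
      central = +-cancelʳ-≡ (dot ls y′) _ _ (trans (⊟-dot y y′ (⊕≤m x₂∈ x₂∈))
        (trans (+-comm (dot ls y) κ) (cong (κ +_) (trans (dot-+ ls x₁ x₃) (trans dots (sym (dot-+ ls x₂ x₂)))))))
      x₁≡x₂ : x₁ ≡ x₂
      x₁≡x₂ = sphere-convex x₁ x₂ x₃ (proj₂ (∈-sphere x₁∈)) (proj₂ (∈-sphere x₂∈)) (proj₂ (∈-sphere x₃∈))
        λ c → trans (sym (lookup-zipWith _+_ c x₁ x₃))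
          (trans (⊟-≡m y y′ (⊕≤m x₂∈ x₂∈) c (proper (⊟-∈ y y′ (⊕≤m x₁∈ x₃∈)) central c)) (lookup-zipWith _+_ c x₂ x₂))

    no-red : ¬ MonoAP colouring true 3 n
    no-red (a , d , _ , d≥1 , ap) = <⇒≢ d≥1 (sym (d≡0 (no-red-triple (a + 0 * d) (a + 1 * d) (a + 2 * d)
      (proj₁ ap₀) (proj₁ ap₁) (proj₁ ap₂) (mid a d) (proj₂ ap₀) (proj₂ ap₁) (proj₂ ap₂))))
      where
      ap₀ = ap 0 (s≤s z≤n)
      ap₁ = ap 1 (s≤s (s≤s z≤n))
      ap₂ = ap 2 (s≤s (s≤s (s≤s z≤n)))
      mid : ∀ a d → a + 0 * d + (a + 2 * d) ≡ a + 1 * d + (a + 1 * d)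
      mid = solve-∀
      d≡0 : a + 0 * d ≡ a + 1 * d → d ≡ 0
      d≡0 eq = trans (sym (*-identityˡ d)) (sym (+-cancelˡ-≡ a _ _ eq))

    lit-point : ∀ a d {u} → Valid (a , d) → (∀ {e} → e ∈ family (a , d) → u ∈ e →
                ∃[ j ] ∃[ x ] (j < k × x ∈ S × u ≡ place (a + j * d + dot ls x)))
    lit-point a d _ e∈ u∈ with valid? (a , d)
    lit-point a d _ (here refl) u∈ | yes (d≥1 , d≤n , inside)
      with ∈-map⁻ _ (proj₂ (proj₂ (proj₂ (Progression.hits a d d≥1 d≤n (λ i → inside)))) u∈)
    ... | (j , x) , jx∈ , eq with ∈-cartesianProduct⁻ (upTo k) S jx∈
    ...   | j∈ , x∈ = j , x , ∈-upTo⁻ j∈ , x∈ , eq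
    lit-point a d _ () u∈ | no _

    family-nonempty : ∀ ad → Valid ad → ∃[ e ] (e ∈ family ad)
    family-nonempty (a , d) v with valid? (a , d)
    ... | yes _ = _ , here refl
    ... | no ¬v = ⊥-elim (¬v v)

    -- U meets the list chosen for this progression, and a common point has the form a + j d + λ·x
    -- with x in S; this makes the term a + j d red.
    no-blue : ¬ MonoAP colouring false k n
    no-blue (a , d , _ , d≥1 , ap) with family-nonempty (a , d) (valid d≥1 (λ i → proj₁ ∘ ap i))
    ... | e , e∈ with proj₂ (proj₂ random-set) (∈-concatMap⁺ family (lose ad∈ e∈))
      where
      ad∈ : (a , d) ∈ grid
      ad∈ = ∈-cartesianProduct⁺ (∈-upTo⁺ (s≤s (≤-trans (m≤m+n a _) (proj₁ (ap 1 k≥2)))))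
              (∈-upTo⁺ (s≤s (proj₁ (proj₂ (valid d≥1 (λ i → proj₁ ∘ ap i))))))
    ...   | u , u∈ , lit with lit-point a d (valid d≥1 (λ i → proj₁ ∘ ap i)) e∈ u∈
    ...     | j , x , j<k , x∈ , refl = true≢false (trans (sym (dec-true (red? (a + j * d)) (lose x∈ lit))) (proj₂ (ap j j<k)))
      where
      true≢false : true ≢ false
      true≢false ()

-- Choice of the parameters

n<2^n : ∀ n → n < 2 ^ n
n<2^n zero    = s≤s z≤n
n<2^n (suc n) = begin-strict
  suc n             <⟨ s<s (n<2^n n) ⟩
  suc (2 ^ n)       ≤⟨ +-monoˡ-≤ (2 ^ n) (m^n>0 2 n) ⟩
  2 ^ n + 2 ^ n     ≡⟨ cong (2 ^ n +_) (sym (+-identityʳ (2 ^ n))) ⟩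
  2 ^ suc n         ∎
  where open ≤-Reasoning

-- Let q be the quotient of n by 2p; the hypothesis gives 2p ≤ q. Then n ≤ (q + 1) 2p ≤ 2^q 2^q, and
-- the p-th power is at most 2^(2pq) ≤ 2^n.
power≤exponential : ∀ p n .{{_ : NonZero p}} → (p + p) * (p + p) ≤ n → n ^ p ≤ 2 ^ n
power≤exponential p@(suc _) n ww≤n = begin
  n ^ p                 ≤⟨ ^-monoˡ-≤ p n≤ ⟩
  (2 ^ (q + q)) ^ p     ≡⟨ ^-*-assoc 2 (q + q) p ⟩
  2 ^ ((q + q) * p)     ≤⟨ ^-monoʳ-≤ 2 (≤-trans (≤-reflexive (double q p)) (m/n*n≤m n w)) ⟩
  2 ^ n                 ∎
  where
  open ≤-Reasoning
  w = p + p
  q = n / w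
  double : ∀ q p → (q + q) * p ≡ q * (p + p)
  double = solve-∀
  w≤q : w ≤ q
  w≤q = subst (_≤ q) (m*n/n≡m w w) (/-monoˡ-≤ w ww≤n)
  n≤ : n ≤ 2 ^ (q + q)
  n≤ = begin
    n                     ≡⟨ m≡m%n+[m/n]*n n w ⟩
    n % w + q * w         ≤⟨ +-monoˡ-≤ (q * w) (<⇒≤ (m%n<n n w)) ⟩
    suc q * w             ≤⟨ *-mono-≤ (n<2^n q) (≤-trans w≤q (<⇒≤ (n<2^n q))) ⟩
    2 ^ q * 2 ^ q         ≡⟨ sym (^-distribˡ-+-* 2 q q) ⟩
    2 ^ (q + q)           ∎

-- Bernoulli's inequality (1 + 1/b)^j ≥ 1 + j/b with the denominators cleared.
bernoulli : ∀ b j → b ^ j * (b + j) ≤ (1 + b) ^ j * b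
bernoulli b zero    = ≤-reflexive (cong (_+ 0) (+-identityʳ b))
bernoulli b (suc j) = begin
  b * b ^ j * (b + suc j)                 ≤⟨ m≤m+n _ (b ^ j * j) ⟩
  b * b ^ j * (b + suc j) + b ^ j * j     ≡⟨ expand b j (b ^ j) ⟩
  (1 + b) * (b ^ j * (b + j))             ≤⟨ *-monoʳ-≤ (1 + b) (bernoulli b j) ⟩
  (1 + b) * ((1 + b) ^ j * b)             ≡⟨ sym (*-assoc (1 + b) ((1 + b) ^ j) b) ⟩
  (1 + b) ^ suc j * b                     ∎
  where
  open ≤-Reasoning
  expand : ∀ b j x → b * x * (b + suc j) + x * j ≡ (1 + b) * (x * (b + j))
  expand = solve-∀

^-distribʳ-* : ∀ a b n → (a * b) ^ n ≡ a ^ n * b ^ n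
^-distribʳ-* a b zero    = refl
^-distribʳ-* a b (suc n) = trans (cong (a * b *_) (^-distribʳ-* a b n)) (interchange a b (a ^ n) (b ^ n))
  where
  interchange : ∀ a b x y → a * b * (x * y) ≡ a * x * (b * y)
  interchange = solve-∀

-- The case j = b of Bernoulli's inequality says (1 + 1/b)^b ≥ 2; this is its t-th power.
doubling : ∀ b t .{{_ : NonZero b}} → 2 ^ t * b ^ (b * t) ≤ (1 + b) ^ (b * t)
doubling b t = begin
  2 ^ t * b ^ (b * t)     ≡⟨ cong (2 ^ t *_) (sym (^-*-assoc b b t)) ⟩
  2 ^ t * (b ^ b) ^ t     ≡⟨ sym (^-distribʳ-* 2 (b ^ b) t) ⟩
  (2 * b ^ b) ^ t         ≤⟨ ^-monoˡ-≤ t (*-cancelʳ-≤ _ _ b (≤-trans (≤-reflexive (twice b (b ^ b))) (bernoulli b b))) ⟩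
  ((1 + b) ^ b) ^ t       ≡⟨ ^-*-assoc (1 + b) b t ⟩
  (1 + b) ^ (b * t)       ∎
  where
  open ≤-Reasoning
  twice : ∀ b x → 2 * x * b ≡ x * (b + b)
  twice = solve-∀

-- Verification of the inequalities in powers of `L`

module Exponents (A B D E H s L : ℕ) .{{_ : NonZero L}}
  (D<B : D + 2 ≤ B) (B<A : B + 2 ≤ A) (E≥1 : 1 ≤ E) (D<H : D + 2 ≤ H)
  (generic-room : A + 2 + (D + E + 2) * suc s ≤ B * suc s)
  (enough-hits : H + s + 4 ≤ D + E) (few-triples : A + D + 3 ≤ 2 * H)
  (L≥300 : 300 ≤ L) (L>D : suc D ≤ L) (L≥5^D : 5 ^ D ≤ L) (L-exp : L ^ (H + 2 * A + 1) ≤ 2 ^ L)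
  where

  open ≤-Reasoning

  k n N b h : ℕ
  k = L ^ E
  n = L ^ A
  N = L ^ B
  b = L ^ H
  h = L ^ H * L

  -- One extra factor `L` absorbs any numerical constant; the largest is 288, from the triples.
  small : ∀ {a} → a ≤ 300 → a ≤ L
  small a≤ = ≤-trans a≤ L≥300

  pow-+ : ∀ x y → L ^ x * L ^ y ≡ L ^ (x + y)
  pow-+ x y = sym (^-distribˡ-+-* L x y)

  pow-mono : ∀ {x y} → x ≤ y → L ^ x ≤ L ^ y
  pow-mono = ^-monoʳ-≤ L

  pow>0 : ∀ x → 1 ≤ L ^ x
  pow>0 x = m^n>0 L x

  absorb : ∀ a x → a ≤ 300 → a * L ^ x ≤ L ^ suc x
  absorb a x a≤ = *-monoˡ-≤ (L ^ x) (small a≤)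

  Δ W : ℕ
  Δ = length (Construction.differences D L k n N s b h)
  W = length (Construction.systems D L k n N s b h)

  Δ≤ : Δ ≤ L ^ suc D
  Δ≤ = begin
    Δ                                   ≡⟨ trans (length-vecs (upTo (suc (L + L + (L + L)))) D) (cong (_^ D) (length-upTo _)) ⟩
    suc (L + L + (L + L)) ^ D           ≤⟨ ^-monoˡ-≤ D (≤-trans (+-monoˡ-≤ _ (small (s≤s z≤n))) (≤-reflexive (five L))) ⟩
    (5 * L) ^ D                         ≡⟨ ^-distribʳ-* 5 L D ⟩
    5 ^ D * L ^ D                       ≤⟨ *-monoˡ-≤ (L ^ D) L≥5^D ⟩
    L ^ suc D                           ∎
    where
    five : ∀ l → l + (l + l + (l + l)) ≡ 5 * l
    five = solve-∀

  W≤ : W ≤ L ^ ((D + E + 2) * suc s)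
  W≤ = begin
    W                                   ≡⟨ trans (length-vecs (cartesianProduct (Construction.differences D L k n N s b h) (upTo (suc (k + k)))) (suc s))
                                             (cong (_^ suc s) (trans (length-cartesianProductWith _,_ (Construction.differences D L k n N s b h) (upTo (suc (k + k)))) (cong (Δ *_) (length-upTo _)))) ⟩
    (Δ * suc (k + k)) ^ suc s           ≤⟨ ^-monoˡ-≤ (suc s) (*-mono-≤ Δ≤ 2k) ⟩
    (L ^ suc D * L ^ suc E) ^ suc s     ≡⟨ cong (_^ suc s) (trans (pow-+ (suc D) (suc E)) (cong (L ^_) (shift D E))) ⟩
    (L ^ (D + E + 2)) ^ suc s           ≡⟨ ^-*-assoc L (D + E + 2) (suc s) ⟩
    L ^ ((D + E + 2) * suc s)           ∎
    where
    shift : ∀ D E → suc D + suc E ≡ D + E + 2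
    shift = solve-∀
    three : ∀ k → k + (k + k) ≡ 3 * k
    three = solve-∀
    2k : suc (k + k) ≤ L ^ suc E
    2k = ≤-trans (+-monoˡ-≤ (k + k) (pow>0 E)) (≤-trans (≤-reflexive (three k)) (absorb 3 E (m≤m+n 3 297)))

  suc-n≤ : suc n ≤ 2 * n
  suc-n≤ = ≤-trans (+-monoˡ-≤ n (pow>0 A)) (≤-reflexive (two n))
    where
    two : ∀ k → k + k ≡ 2 * k
    two = solve-∀

  room : N ^ s * Δ + suc n * W < N ^ suc s
  room = begin-strict
    N ^ s * Δ + suc n * W                                       ≤⟨ +-mono-≤ degenerate dependent ⟩
    L ^ x + L ^ x                                               ≡⟨ two (L ^ x) ⟩
    2 * L ^ x                                                   <⟨ *-monoˡ-< (L ^ x) {{m^n≢0 L x}} (≤-trans (m≤m+n 3 297) L≥300) ⟩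
    L ^ suc x                                                   ≡⟨ cong (L ^_) (suc-pred (B * suc s) {{>-nonZero Bs>0}}) ⟩
    L ^ (B * suc s)                                             ≡⟨ sym (^-*-assoc L B (suc s)) ⟩
    N ^ suc s                                                   ∎
    where
    -- One below the target exponent: both summands fit under `L ^ x`, and `2 < L` makes their sum
    -- strictly smaller than `L ^ suc x`.
    x = pred (B * suc s)
    two : ∀ k → k + k ≡ 2 * k
    two = solve-∀
    Bs>0 : 0 < B * suc s
    Bs>0 = ≤-trans (≤-trans (s≤s z≤n) (≤-trans (m≤n+m 2 A) (m≤m+n (A + 2) _))) generic-room
    rearrange : ∀ B s D → suc (B * s + suc D) ≡ D + 2 + B * s
    rearrange = solve-∀
    rearrange′ : ∀ A y → suc (suc A + y) ≡ A + 2 + y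
    rearrange′ = solve-∀
    degenerate : N ^ s * Δ ≤ L ^ x
    degenerate = begin
      N ^ s * Δ                 ≤⟨ *-monoʳ-≤ (N ^ s) Δ≤ ⟩
      N ^ s * L ^ suc D         ≡⟨ cong (_* L ^ suc D) (^-*-assoc L B s) ⟩
      L ^ (B * s) * L ^ suc D   ≡⟨ pow-+ (B * s) (suc D) ⟩
      L ^ (B * s + suc D)       ≤⟨ pow-mono (<⇒≤pred (≤-trans (≤-reflexive (rearrange B s D))
                                      (≤-trans (+-monoˡ-≤ (B * s) D<B) (≤-reflexive (sym (*-suc B s)))))) ⟩
      L ^ x                     ∎
    dependent : suc n * W ≤ L ^ x
    dependent = begin
      suc n * W                                   ≤⟨ *-mono-≤ (≤-trans suc-n≤ (absorb 2 A (m≤m+n 2 298))) W≤ ⟩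
      L ^ suc A * L ^ ((D + E + 2) * suc s)       ≡⟨ pow-+ (suc A) _ ⟩
      L ^ (suc A + (D + E + 2) * suc s)           ≤⟨ pow-mono (<⇒≤pred (≤-trans (≤-reflexive (rearrange′ A _)) generic-room)) ⟩
      L ^ x                                       ∎

  -- The 4 in `enough-hits` is 3 for the number of possible norms, at most `L ^ 3`, and 1 for the
  -- factor `L` in `h`.
  mass : suc (D * (L * L)) * (h * L ^ s) ≤ k * L ^ D
  mass = begin
    suc (D * (L * L)) * (h * L ^ s)       ≤⟨ *-monoˡ-≤ (h * L ^ s) values ⟩
    L ^ 3 * (h * L ^ s)                   ≡⟨ cong (λ z → L ^ 3 * (L ^ H * z * L ^ s)) (sym (^-identityʳ L)) ⟩
    L ^ 3 * (L ^ H * L ^ 1 * L ^ s)       ≡⟨ cong (λ z → L ^ 3 * (z * L ^ s)) (pow-+ H 1) ⟩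
    L ^ 3 * (L ^ (H + 1) * L ^ s)         ≡⟨ cong (L ^ 3 *_) (pow-+ (H + 1) s) ⟩
    L ^ 3 * L ^ (H + 1 + s)               ≡⟨ pow-+ 3 (H + 1 + s) ⟩
    L ^ (3 + (H + 1 + s))                 ≡⟨ cong (L ^_) (collect H s) ⟩
    L ^ (H + s + 4)                       ≤⟨ pow-mono (≤-trans enough-hits (≤-reflexive (+-comm D E))) ⟩
    L ^ (E + D)                           ≡⟨ sym (pow-+ E D) ⟩
    k * L ^ D                             ∎
    where
    collect : ∀ H s → 3 + (H + 1 + s) ≡ H + s + 4
    collect = solve-∀
    cube : ∀ l → l * (l * l) ≡ l * (l * (l * 1))
    cube = solve-∀
    values : suc (D * (L * L)) ≤ L ^ 3
    values = begin
      suc (D * (L * L))       ≤⟨ +-monoˡ-≤ (D * (L * L)) (*-mono-≤ (small (s≤s z≤n)) (small (s≤s z≤n))) ⟩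
      suc D * (L * L)         ≤⟨ *-monoˡ-≤ (L * L) L>D ⟩
      L * (L * L)             ≡⟨ cube L ⟩
      L ^ 3                   ∎

  1≤b : 1 ≤ b
  1≤b = pow>0 H

  k≥2 : 2 ≤ k
  k≥2 = ≤-trans (small (m≤m+n 2 298)) (≤-trans (≤-reflexive (sym (^-identityʳ L))) (pow-mono E≥1))

  h>0 : 0 < h
  h>0 = *-mono-≤ 1≤b (small (s≤s z≤n))

  Q≤ : 2 + b ≤ 2 * (1 + b)
  Q≤ = ≤-trans (m≤m+n (2 + b) b) (≤-reflexive (double b))
    where
    double : ∀ b → 2 + b + b ≡ 2 * (1 + b)
    double = solve-∀

  rare₂ : 3 * (2 + b) * (Δ * 4 * 2 ^ 2) ≤ (1 + b) ^ 2
  rare₂ = begin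
    3 * (2 + b) * (Δ * 4 * 2 ^ 2)        ≤⟨ *-mono-≤ (*-monoʳ-≤ 3 Q≤) (*-monoˡ-≤ 4 (*-monoˡ-≤ 4 Δ≤)) ⟩
    3 * (2 * (1 + b)) * (L ^ suc D * 4 * 4)  ≡⟨ collect (1 + b) (L ^ suc D) ⟩
    (1 + b) * (96 * L ^ suc D)           ≤⟨ *-monoʳ-≤ (1 + b) (≤-trans (absorb 96 (suc D) (m≤m+n 96 204))
                                            (≤-trans (pow-mono (≤-trans (≤-reflexive (+-comm 2 D)) D<H)) (n≤1+n b))) ⟩
    (1 + b) * (1 + b)                    ≡⟨ cong ((1 + b) *_) (sym (*-identityʳ (1 + b))) ⟩
    (1 + b) ^ 2                          ∎
    where
    collect : ∀ q x → 3 * (2 * q) * (x * 4 * 4) ≡ q * (96 * x)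
    collect = solve-∀

  V≤ : Construction.V D L k n N s b h ≤ 3 * n
  V≤ = begin
    suc (n + D * (N * L))    ≤⟨ s≤s (+-monoʳ-≤ n (begin
      D * (N * L)               ≤⟨ *-monoˡ-≤ (N * L) (≤-trans (n≤1+n D) L>D) ⟩
      L * (N * L)               ≡⟨ cong (L *_) (*-comm N L) ⟩
      L ^ suc (suc B)           ≤⟨ pow-mono (≤-trans (≤-reflexive (+-comm 2 B)) B<A) ⟩
      n                         ∎)) ⟩
    suc (n + n)              ≤⟨ +-monoˡ-≤ (n + n) (pow>0 A) ⟩
    n + (n + n)              ≡⟨ three n ⟩
    3 * n                    ∎
    where
    three : ∀ k → k + (k + k) ≡ 3 * k
    three = solve-∀

  rare₃ : 3 * (2 + b) * (Construction.V D L k n N s b h * (Δ * 2) * 2 ^ 3) ≤ (1 + b) ^ 3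
  rare₃ = begin
    3 * (2 + b) * (Construction.V D L k n N s b h * (Δ * 2) * 2 ^ 3)
      ≤⟨ *-mono-≤ (*-monoʳ-≤ 3 Q≤) (*-monoˡ-≤ 8 (*-mono-≤ V≤ (*-monoˡ-≤ 2 Δ≤))) ⟩
    3 * (2 * (1 + b)) * (3 * n * (L ^ suc D * 2) * 8)
      ≡⟨ collect (1 + b) n (L ^ suc D) ⟩
    (1 + b) * (288 * (n * L ^ suc D))
      ≤⟨ *-monoʳ-≤ (1 + b) (begin
        288 * (n * L ^ suc D)       ≡⟨ cong (288 *_) (pow-+ A (suc D)) ⟩
        288 * L ^ (A + suc D)       ≤⟨ absorb 288 (A + suc D) (m≤m+n 288 12) ⟩
        L ^ suc (A + suc D)         ≤⟨ pow-mono (≤-trans (≤-trans (n≤1+n _) (≤-reflexive (shift A D))) few-triples) ⟩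
        L ^ (2 * H)                 ≡⟨ trans (cong (L ^_) (double H)) (^-distribˡ-+-* L H H) ⟩
        b * b                       ≤⟨ *-mono-≤ (n≤1+n b) (n≤1+n b) ⟩
        (1 + b) * (1 + b)           ∎) ⟩
    (1 + b) * ((1 + b) * (1 + b))   ≡⟨ cong (λ z → (1 + b) * ((1 + b) * z)) (sym (*-identityʳ (1 + b))) ⟩
    (1 + b) ^ 3                     ∎
    where
    collect : ∀ q n x → 3 * (2 * q) * (3 * n * (x * 2) * 8) ≡ q * (288 * (n * x))
    collect = solve-∀
    shift : ∀ A D → suc (suc (A + suc D)) ≡ A + D + 3
    shift = solve-∀
    double : ∀ H → 2 * H ≡ H + H
    double = solve-∀

  -- Since `h` is `b * L`, the ratio of `b ^ h` to `(1 + b) ^ h` is at most 2^-L, which beats the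
  -- number of events, a fixed power of `L`.
  rareᵇ : 3 * (2 + b) * (suc n * suc n * b ^ h) ≤ (1 + b) ^ h
  rareᵇ = begin
    3 * (2 + b) * (suc n * suc n * b ^ h)       ≡⟨ sym (*-assoc (3 * (2 + b)) (suc n * suc n) (b ^ h)) ⟩
    3 * (2 + b) * (suc n * suc n) * b ^ h       ≤⟨ *-monoˡ-≤ (b ^ h) (begin
      3 * (2 + b) * (suc n * suc n)                ≤⟨ *-mono-≤ (*-monoʳ-≤ 3 2+b≤) (*-mono-≤ suc-n≤ suc-n≤) ⟩
      3 * (3 * b) * (2 * n * (2 * n))              ≡⟨ collect b n ⟩
      36 * (b * (n * n))                           ≡⟨ cong (λ z → 36 * (b * z)) (pow-+ A A) ⟩
      36 * (b * L ^ (A + A))                       ≡⟨ cong (36 *_) (pow-+ H (A + A)) ⟩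
      36 * L ^ (H + (A + A))                       ≤⟨ absorb 36 (H + (A + A)) (m≤m+n 36 264) ⟩
      L ^ suc (H + (A + A))                        ≡⟨ cong (L ^_) (shift H A) ⟩
      L ^ (H + 2 * A + 1)                          ≤⟨ L-exp ⟩
      2 ^ L                                        ∎) ⟩
    2 ^ L * b ^ h                               ≤⟨ doubling b L {{m^n≢0 L H}} ⟩
    (1 + b) ^ h                                 ∎
    where
    2+b≤ : 2 + b ≤ 3 * b
    2+b≤ = ≤-trans (+-monoˡ-≤ b (*-monoʳ-≤ 2 1≤b)) (≤-reflexive (three b))
      where
      three : ∀ b → 2 * b + b ≡ 3 * b
      three = solve-∀
    collect : ∀ b n → 3 * (3 * b) * (2 * n * (2 * n)) ≡ 36 * (b * (n * n))
    collect = solve-∀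
    shift : ∀ H A → suc (H + (A + A)) ≡ H + 2 * A + 1
    shift = solve-∀

  open Construction D L k n N s b h using (colouring; no-red; no-blue)

  abstract
    good-colouring : ∃[ c ] (¬ MonoAP c true 3 n × ¬ MonoAP c false k n)
    good-colouring = colouring room mass k≥2 h>0 rare₂ rare₃ rareᵇ , no-red room mass k≥2 h>0 rare₂ rare₃ rareᵇ , no-blue room mass k≥2 h>0 rare₂ rare₃ rareᵇ

-- Rounding `k` to a power of `L`, and the final bound

nth-root : ∀ E k → 1 ≤ E → ∃[ L ] (L ^ E ≤ k × k < suc L ^ E)
nth-root E@(suc _) zero    E≥1 = 0 , z≤n , m^n>0 1 E
nth-root E (suc k) E≥1 with nth-root E k E≥1
... | L , lo , hi with suc k <? suc L ^ E
...   | yes lt = L , m≤n⇒m≤1+n lo , lt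
...   | no ≮   = suc L , ≮⇒≥ ≮ , ≤-<-trans hi (^-monoˡ-< E {{>-nonZero E≥1}} (n<1+n (suc L)))

eventually : ∀ z A D p .{{_ : NonZero p}} → ∃[ L₀ ] (∀ L → L₀ ≤ L →
             z ≤ L × suc D ≤ L × 5 ^ D ≤ L × 2 ^ A ≤ L × L ^ p ≤ 2 ^ L)
eventually z A D p = z + (suc D + (5 ^ D + (2 ^ A + (p + p) * (p + p)))) , λ L L₀≤L →
  let L₁≤L = ≤-trans (m≤n+m _ z) L₀≤L
      L₂≤L = ≤-trans (m≤n+m _ (suc D)) L₁≤L
      L₃≤L = ≤-trans (m≤n+m _ (5 ^ D)) L₂≤L
  in ≤-trans (m≤m+n z _) L₀≤L , ≤-trans (m≤m+n (suc D) _) L₁≤L , ≤-trans (m≤m+n (5 ^ D) _) L₂≤L ,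
     ≤-trans (m≤m+n (2 ^ A) _) L₃≤L , power≤exponential p L (≤-trans (m≤n+m _ (2 ^ A)) L₃≤L)

Admissible : (A B D E H s : ℕ) → Set
Admissible A B D E H s =
  D + 2 ≤ B × B + 2 ≤ A × 1 ≤ E × D + 2 ≤ H × A + 2 + (D + E + 2) * suc s ≤ B * suc s
  × H + s + 4 ≤ D + E × A + D + 3 ≤ 2 * H

-- In base L the exponents of n, N, k and b are A, B, E and H. With g = B − D − E − 2 the fifth
-- condition says A + 2 ≤ g (s + 1), and, for the largest H, the last one says 2 s + g + 15 ≤ E;
-- g = E / 2 and s = 2 c + 4 satisfy both.
abstract
  exponents : ∀ c → ∃[ A ] ∃[ B ] ∃[ D ] ∃[ E ] ∃[ H ] ∃[ s ]
              (Admissible A B D E H s × suc (E * (2 + c)) ≡ A)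
  exponents c =
    8 * (c * c) + 64 * c + 97 , 8 * (c * c) + 64 * c + 95 , 8 * (c * c) + 52 * c + 21 ,
    8 * c + 48 , 8 * (c * c) + 58 * c + 61 , 2 * c + 4 ,
    ( by (12 * c + 72) (r₁ c) , by 0 (r₂ c) , by (8 * c + 47) (r₃ c) , by (6 * c + 38) (r₄ c)
    , by (4 * c + 21) (r₅ c) , by 0 (r₆ c) , by 1 (r₇ c)) , r₈ c
    where
    by : ∀ {x y} z → x + z ≡ y → x ≤ y
    by {x} z eq = subst (x ≤_) eq (m≤m+n x z)
    r₁ : ∀ c → 8 * (c * c) + 52 * c + 21 + 2 + (12 * c + 72) ≡ 8 * (c * c) + 64 * c + 95
    r₁ = solve-∀
    r₂ : ∀ c → 8 * (c * c) + 64 * c + 95 + 2 + 0 ≡ 8 * (c * c) + 64 * c + 97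
    r₂ = solve-∀
    r₃ : ∀ c → 1 + (8 * c + 47) ≡ 8 * c + 48
    r₃ = solve-∀
    r₄ : ∀ c → 8 * (c * c) + 52 * c + 21 + 2 + (6 * c + 38) ≡ 8 * (c * c) + 58 * c + 61
    r₄ = solve-∀
    r₅ : ∀ c → 8 * (c * c) + 64 * c + 97 + 2
                 + (8 * (c * c) + 52 * c + 21 + (8 * c + 48) + 2) * suc (2 * c + 4) + (4 * c + 21)
               ≡ (8 * (c * c) + 64 * c + 95) * suc (2 * c + 4)
    r₅ = solve-∀
    r₆ : ∀ c → 8 * (c * c) + 58 * c + 61 + (2 * c + 4) + 4 + 0 ≡ 8 * (c * c) + 52 * c + 21 + (8 * c + 48)
    r₆ = solve-∀
    r₇ : ∀ c → 8 * (c * c) + 64 * c + 97 + (8 * (c * c) + 52 * c + 21) + 3 + 1 ≡ 2 * (8 * (c * c) + 58 * c + 61)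
    r₇ = solve-∀
    r₈ : ∀ c → suc ((8 * c + 48) * (2 + c)) ≡ 8 * (c * c) + 64 * c + 97
    r₈ = solve-∀

MonoAP-mono : ∀ χ {b m m′ n n′} → m′ ≤ m → n ≤ n′ → MonoAP χ b m n → MonoAP χ b m′ n′
MonoAP-mono χ m′≤m n≤n′ (a , d , a≥1 , d≥1 , ap) =
  a , d , a≥1 , d≥1 , λ i i< → ≤-trans (proj₁ (ap i (<-≤-trans i< m′≤m))) n≤n′ , proj₂ (ap i (<-≤-trans i< m′≤m))

-- With `L` the integer part of the `E`-th root of `k`, the colouring made for `L ^ E` and `L ^ A`
-- serves `k`: having no blue progression of length `L ^ E ≤ k` and covering `[L ^ A]` are both
-- stronger than required.
superpolynomial : ∀ c → ∃[ K ] (∀ k → K ≤ k →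
                  ∃[ χ ] (¬ MonoAP χ true 3 (k ^ (2 + c)) × ¬ MonoAP χ false k (k ^ (2 + c))))
superpolynomial c with exponents c
... | A , B , D , E , H , s , (D<B , B<A , E≥1 , D<H , generic-room , enough-hits , few-triples) , eqA
  with eventually 300 A D (H + 2 * A + 1) {{>-nonZero (m≤n+m 1 (H + 2 * A))}}
...   | L₀ , large = L₀ ^ E , colour
  where
  open ≤-Reasoning
  colour : ∀ k → L₀ ^ E ≤ k → ∃[ χ ] (¬ MonoAP χ true 3 (k ^ (2 + c)) × ¬ MonoAP χ false k (k ^ (2 + c)))
  colour k K≤k with nth-root E k E≥1
  ... | L , lo , hi with large L (≮⇒≥ λ L<L₀ → <⇒≱ hi (≤-trans (^-monoˡ-≤ E L<L₀) K≤k))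
  ...   | L≥300 , L>D , L≥5^D , L≥2^A , L-exp
    with Exponents.good-colouring A B D E H s L {{>-nonZero (≤-trans (s≤s z≤n) L≥300)}}
           D<B B<A E≥1 D<H generic-room enough-hits few-triples L≥300 L>D L≥5^D L-exp
  ...     | χ , no-red , no-blue = χ , no-red ∘ MonoAP-mono χ ≤-refl n≤ , no-blue ∘ MonoAP-mono χ lo n≤
    where
    -- Replacing the root by `L` costs at most a factor 2 in the base. The exponent `A` exceeds
    -- `E * (2 + c)` by one, and this spare factor `L ≥ 2 ^ A` pays for it.
    n≤ : k ^ (2 + c) ≤ L ^ A
    n≤ = begin
      k ^ (2 + c)                           ≤⟨ ^-monoˡ-≤ (2 + c) (<⇒≤ hi) ⟩
      (suc L ^ E) ^ (2 + c)                 ≡⟨ ^-*-assoc (suc L) E (2 + c) ⟩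
      suc L ^ (E * (2 + c))                 ≤⟨ ^-monoˡ-≤ (E * (2 + c)) (+-mono-≤ (≤-trans (m^n>0 2 A) L≥2^A) (m≤m+n L 0)) ⟩
      (2 * L) ^ (E * (2 + c))               ≡⟨ ^-distribʳ-* 2 L (E * (2 + c)) ⟩
      2 ^ (E * (2 + c)) * L ^ (E * (2 + c)) ≤⟨ *-monoˡ-≤ (L ^ (E * (2 + c)))
                                                (≤-trans (^-monoʳ-≤ 2 (≤-trans (n≤1+n _) (≤-reflexive eqA))) L≥2^A) ⟩
      L ^ suc (E * (2 + c))                 ≡⟨ cong (L ^_) eqA ⟩
      L ^ A                                 ∎

theorem2 : (r : ℕ) → 3 ≤ r →
    ∃[ D ] ∃[ K ] ((k : ℕ) → K ≤ k → (n : ℕ) → VdWProp r k n →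
    k ^ (r ∸ 1) ≤ D * n * (⌊log₂ k ⌋ ^ (r ∸ 2)))
theorem2 (suc (suc (suc c))) 3≤r@(s≤s (s≤s (s≤s z≤n))) with superpolynomial c
-- The summand 2 makes `k ≥ 2`, so the logarithm is at least 1 and multiplying by its power can only
-- help.
... | K , colour = 1 , 2 + K , bound
  where
  open ≤-Reasoning
  bound : ∀ k → 2 + K ≤ k → ∀ n → VdWProp (3 + c) k n → k ^ (2 + c) ≤ 1 * n * ⌊log₂ k ⌋ ^ (1 + c)
  bound k K≤k n vdw = begin
    k ^ (2 + c)                     ≤⟨ ≮⇒≥ impossible ⟩
    n                               ≡⟨ sym (*-identityˡ n) ⟩
    1 * n                           ≤⟨ m≤m*n (1 * n) (⌊log₂ k ⌋ ^ (1 + c)) {{m^n≢0 ⌊log₂ k ⌋ (1 + c) {{>-nonZero log≥1}}}} ⟩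
    1 * n * ⌊log₂ k ⌋ ^ (1 + c)     ∎
    where
    log≥1 : 1 ≤ ⌊log₂ k ⌋
    log≥1 = subst (_≤ ⌊log₂ k ⌋) (⌊log₂[2^n]⌋≡n 1) (⌊log₂⌋-mono-≤ (≤-trans (m≤m+n 2 K) K≤k))
    impossible : ¬ (n < k ^ (2 + c))
    impossible n< with colour k (≤-trans (m≤n+m K 2) K≤k)
    ... | χ , no-red , no-blue =
      -- A red progression of `r` terms begins with a red one of three terms, so the colouring for
      -- length 3 serves every `r`.
      [ no-red ∘ MonoAP-mono χ 3≤r (<⇒≤ n<) , no-blue ∘ MonoAP-mono χ ≤-refl (<⇒≤ n<) ]′ (vdw χ)
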